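{- If $N_1,N_2,N_3$ are feasible perfect negators, then $G=\operatorname{NNN}(N_1,N_2,N_3)$ is a bicritical snark.
   Context: A multipole consists of vertices and edges; each edge has two ends, each either at a vertex or free (a semiedge); all multipoles are cubic. Let $\mathbb{K}=\{(0,1),(1,0),(1,1)\}\subset\mathbb{Z}_2\times\mathbb{Z}_2$. A colouring of a multipole assigns elements of $\mathbb{K}$ to edges so that the three edge ends at each vertex get distinct colours. A snark is a connected cubic graph with no colouring. For distinct vertices $x,y$ of a graph $G$, $G-\{x,y\}$ is the multipole obtained by deleting $x,y$ (edges to other vertices become dangling edges; an edge $xy$, if present, is kept as an isolated edge). A snark is bicritical if $G-\{x,y\}$ is colourable for all distinct vertices $x,y$. Negator: for a snark $H$ of girth at least $5$ and a path $uwv$ in $H$, $N=\operatorname{Neg}(H;u,v)$ is the $(2,2,1)$-pole $N(I,O,r)$ obtained by deleting $u,w,v$, with $I=\{i_1,i_2\}$ the semiedges formerly at $u$, $O=\{o_1,o_2\}$ those formerly at $v$, and $r$ the one formerly at $w$. $N$ is perfect if the set of tuples $(\varphi(i_1),\varphi(i_2),\varphi(o_1),\varphi(o_2),\varphi(r))$ over its colourings equals $\{(z,z,a,b,a+b),(a,b,z,z,a+b): z,a,b\in\mathbb{K}, a\ne b\}$. $N$ is feasible if (0) $H-\{x,y\}$ is colourable for all distinct $x,y\in V(N)$; (i) for every $x\in\{u,v\}$ and $y\in V(N)$ and any two dangling edges $e,f$ of the $6$-pole $H-\{x,y\}$ formerly incident with $x$, there is a colouring $\varphi$ of $H-\{x,y\}$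 with $\varphi(e)=\varphi(f)$; (ii) for every vertex $y\in V(N)$ there exist colourings $\varphi,\psi$ of the $8$-pole $N-y$ (delete $y$, its edges become dangling) with $\varphi(i_1,i_2,o_1,o_2,r)=(a,a,b,b,a)$ and $\psi(i_1,i_2,o_1,o_2,r)=(a,a,b,b,b)$ for some $a,b\in\mathbb{K}$ with $a\ne b$. For negators $N_j(I_j,O_j,r_j)$, $j=1,2,3$, $\operatorname{NNN}(N_1,N_2,N_3)$ is the cubic graph obtained by performing the junctions (identifying free ends in pairs along arbitrary bijections) of $O_1$ with $I_2$, $O_2$ with $I_3$, $O_3$ with $I_1$, and adding a new vertex incident with $r_1,r_2,r_3$. -}

module Defs where

open import Data.Bool using (Bool; true; false; _xor_)
open import Data.Fin using (Fin; zero; suc; toℕ)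
open import Data.Fin.Permutation using (Permutation′; _⟨$⟩ʳ_)
import Data.Fin.Properties as Fin
open import Data.Irrelevant using ([_])
open import Data.List using (List; []; _∷_; map; _++_; concatMap; allFin; mapMaybe)
open import Data.List.Membership.Propositional using (_∈_; lose)
open import Data.List.Membership.Propositional.Properties using (∈-map⁺; ∈-allFin; ∈-concatMap⁺; ∈-++⁺ˡ; ∈-++⁺ʳ)
open import Data.List.Relation.Unary.Any using (here; there; any?; satisfied)
open import Data.Maybe using (Maybe; just; nothing; _>>=_; Is-just)
import Data.Maybe as Maybe
open import Data.Maybe.Properties using (just-injective)
import Data.Maybe.Properties as Maybe
open import Data.Nat using (ℕ; suc; _≤_; s≤s)
open import Data.Nat.DivMod using (_mod_)
open import Data.Product using (Σ; ∃; _×_; _,_; zip)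
import Data.Product.Properties as Product
open import Data.Refinement using (_,_; value; Refinement-syntax)
open import Data.Sum using (_⊎_; inj₁; inj₂; [_,_]′; swap)
open import Data.Sum.Properties using (swap-involutive)
import Data.Sum.Properties as Sum
open import Data.Vec using (Vec; []; _∷_)
open import Function using (_∘_; _⇔_; Injective; Injection)
open import Function.Properties.Inverse using (↔⇒↣)
open import Relation.Binary using (DecidableEquality)
open import Relation.Binary.Construct.Closure.ReflexiveTransitive using (Star)
open import Relation.Binary.PropositionalEquality using (_≡_; _≢_; refl; sym; trans; cong; subst)
open import Relation.Nullary using (¬_; Dec; yes; no; contradiction; contradiction-irr; ¬?)
open import Relation.Nullary.Decidable using (_⊎-dec_; map′)
open import Relation.Nullary.Recomputable using (¬-recompute)
open import Relation.Unary using (Pred; Decidable)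

record Finite (A : Set) : Set where
  field
    elements : List A
    complete : ∀ a → a ∈ elements
    _≟_      : DecidableEquality A

open Finite

∃? : {A : Set} {P : A → Set} → Finite A → (∀ a → Dec (P a)) → Dec (∃ P)
∃? F P? = map′ satisfied (λ (a , p) → lose (complete F a) p) (any? P? (elements F))

module _ {A : Set} {P : A → Set} (P? : ∀ a → Dec (P a)) where

  refine? : A → Maybe [ a ∈ A ∣ P a ]
  refine? a with P? a
  ... | yes p = just (a , [ p ])
  ... | no  _ = nothing

  refine?-value : ∀ {a b} → refine? a ≡ just b → value b ≡ a
  refine?-value {a} eq with P? a
  refine?-value refl | yes _ = refl

  refine?-just : ∀ a .(p : P a) → refine? a ≡ just (a , [ p ])
  refine?-just a p with P? a
  ... | yes _ = refl
  ... | no ¬p = contradiction-irr p ¬p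

  ∈-mapMaybe-refine? : ∀ {a as} .(p : P a) → a ∈ as → (a , [ p ]) ∈ mapMaybe refine? as
  ∈-mapMaybe-refine? {a} p (here refl) rewrite refine?-just a p = here refl
  ∈-mapMaybe-refine? {as = b ∷ _} p (there a∈) with refine? b
  ... | just _  = there (∈-mapMaybe-refine? p a∈)
  ... | nothing = ∈-mapMaybe-refine? p a∈

  value-injective : {x y : [ a ∈ A ∣ P a ]} → value x ≡ value y → x ≡ y
  value-injective refl = refl

  finite-refinement : Finite A → Finite [ a ∈ A ∣ P a ]
  finite-refinement F = record
    { elements = mapMaybe refine? (elements F)
    ; complete = λ { (a , [ p ]) → ∈-mapMaybe-refine? p (complete F a) }
    ; _≟_      = λ x y → map′ value-injective (cong value) (_≟_ F (value x) (value y))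
    }

finite-Fin : ∀ n → Finite (Fin n)
finite-Fin n = record { elements = allFin n ; complete = ∈-allFin ; _≟_ = Fin._≟_ }

finite-Σ : {A : Set} {B : A → Set} → Finite A → (∀ a → Finite (B a)) → Finite (Σ A B)
finite-Σ {A} {B} F G = record
  { elements = concatMap slice (elements F)
  ; complete = λ (a , b) →
      ∈-concatMap⁺ slice (lose (complete F a) (∈-map⁺ (a ,_) (complete (G a) b)))
  ; _≟_      = Product.≡-dec (_≟_ F) (λ {a} → _≟_ (G a))
  }
  where
  slice : A → List (Σ A B)
  slice a = map (a ,_) (elements (G a))

finite-⊎ : {A B : Set} → Finite A → Finite B → Finite (A ⊎ B)
finite-⊎ F G = record
  { elements = map inj₁ (elements F) ++ map inj₂ (elements G)
  ; complete = λ { (inj₁ a) → ∈-++⁺ˡ (∈-map⁺ inj₁ (complete F a))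
                 ; (inj₂ b) → ∈-++⁺ʳ (map inj₁ (elements F)) (∈-map⁺ inj₂ (complete G b)) }
  ; _≟_      = Sum.≡-dec (_≟_ F) (_≟_ G)
  }

finite-Maybe : {A : Set} → Finite A → Finite (Maybe A)
finite-Maybe F = record
  { elements = nothing ∷ map just (elements F)
  ; complete = λ { nothing → here refl ; (just a) → there (∈-map⁺ just (complete F a)) }
  ; _≟_      = Maybe.≡-dec (_≟_ F)
  }

ExactlyThree : {A : Set} → (A → Set) → Set
ExactlyThree {A} P = ∃ λ (d : Fin 3 → A) →
  Injective _≡_ _≡_ d × (∀ i → P (d i)) × (∀ a → P a → ∃ λ i → d i ≡ a)

-- An edge is a pair {e , other e} of edge ends; at e is nothing when the
-- end e is free (a semiedge).  Loops and parallel edges are allowed.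
record Multipole : Set₁ where
  field
    V   : Set
    End : Set
    finiteV   : Finite V
    finiteEnd : Finite End
    other            : End → End
    other-involutive : ∀ e → other (other e) ≡ e
    other-≢          : ∀ e → other e ≢ e
    at    : End → Maybe V
    cubic : ∀ v → ExactlyThree (λ e → at e ≡ just v)

  Free : Pred End _
  Free e = at e ≡ nothing

  -- e is the free end of an edge whose other end is at a vertex.
  Dangling : Pred End _
  Dangling e = Free e × Is-just (at (other e))

  Adjacent : V → V → Set
  Adjacent x y = ∃ λ e → at e ≡ just x × at (other e) ≡ just y

  other-injective : Injective _≡_ _≡_ other
  other-injective {e} {f} eq =
    trans (sym (other-involutive e)) (trans (cong other eq) (other-involutive f))

open Multipole

-- Deletes the vertices in P; all edges are kept, so that an edge between two
-- deleted vertices becomes an isolated edge.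
delete : (M : Multipole) {P : V M → Set} → Decidable P → Multipole
delete M {P} P? = record
  { V = [ v ∈ V M ∣ ¬ P v ]
  ; End = End M
  ; finiteV = finite-refinement ¬P? (finiteV M)
  ; finiteEnd = finiteEnd M
  ; other = other M
  ; other-involutive = other-involutive M
  ; other-≢ = other-≢ M
  ; at = λ e → at M e >>= refine? ¬P?
  ; cubic = cubic′
  }
  where
  ¬P? : Decidable (λ v → ¬ P v)
  ¬P? v = ¬? (P? v)

  at⇒ : ∀ e {v} → (at M e >>= refine? ¬P?) ≡ just v → at M e ≡ just (value v)
  at⇒ e eq with at M e
  ... | just x = cong just (sym (refine?-value ¬P? eq))

  cubic′ : (v : [ x ∈ V M ∣ ¬ P x ]) → ExactlyThree (λ e → (at M e >>= refine? ¬P?) ≡ just v)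
  cubic′ (v , [ p ]) =
    let d , inj , d-at , onto = cubic M v in
    d , inj
    , (λ i → trans (cong (_>>= refine? ¬P?) (d-at i)) (refine?-just ¬P? v p))
    , (λ e eq → onto e (at⇒ e eq))

deleteVertex : (M : Multipole) → V M → Multipole
deleteVertex M y = delete M {P = _≡ y} (λ z → _≟_ (finiteV M) z y)

deletePair : (M : Multipole) → V M → V M → Multipole
deletePair M x y = delete M {P = λ z → z ≡ x ⊎ z ≡ y}
  (λ z → _≟_ (finiteV M) z x ⊎-dec _≟_ (finiteV M) z y)

-- Discards the (isolated) edges whose ends satisfy P.
discard : (M : Multipole) {P : End M → Set} → Decidable P →
          (∀ e → P e → Free M e) → (∀ e → P (other M e) → P e) → Multipole
discard M {P} P? free closed = record
  { V = V M
  ; End = [ e ∈ End M ∣ ¬ P e ]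
  ; finiteV = finiteV M
  ; finiteEnd = finite-refinement ¬P? (finiteEnd M)
  ; other = λ { (e , [ p ]) → other M e , [ (λ q → p (closed e q)) ] }
  ; other-involutive = λ { (e , [ _ ]) → value-injective ¬P? (other-involutive M e) }
  ; other-≢ = λ { (e , [ _ ]) eq → other-≢ M e (cong value eq) }
  ; at = λ e → at M (value e)
  ; cubic = λ v →
      let d , inj , d-at , onto = cubic M v in
      (λ i → d i , [ (λ p → contradiction (trans (sym (d-at i)) (free (d i) p)) λ ()) ])
      , (λ eq → inj (cong value eq))
      , d-at
      , (λ e eq → let i , di≡e = onto (value e) eq in i , value-injective ¬P? di≡e)
  }
  where
  ¬P? : Decidable (λ e → ¬ P e)
  ¬P? e = ¬? (P? e)

inj-tag : {A : Set} {B : A → Set} {a : A} {b c : B a} → _≡_ {A = Σ A B} (a , b) (a , c) → b ≡ c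
inj-tag refl = refl

∐ : ∀ {n} → (Fin n → Multipole) → Multipole
∐ {n} M = record
  { V = Σ (Fin n) (V ∘ M)
  ; End = Σ (Fin n) (End ∘ M)
  ; finiteV = finite-Σ (finite-Fin n) (finiteV ∘ M)
  ; finiteEnd = finite-Σ (finite-Fin n) (finiteEnd ∘ M)
  ; other = λ (j , e) → j , other (M j) e
  ; other-involutive = λ (j , e) → cong (j ,_) (other-involutive (M j) e)
  ; other-≢ = λ { (j , e) eq → other-≢ (M j) e (inj-tag eq) }
  ; at = at′
  ; cubic = λ (j , v) →
      let d , inj , d-at , onto = cubic (M j) v in
      (λ i → j , d i)
      , (λ eq → inj (inj-tag eq))
      , (λ i → cong (Maybe.map (j ,_)) (d-at i))
      , onto′ j v d onto
  }
  where
  at′ : Σ (Fin n) (End ∘ M) → Maybe (Σ (Fin n) (V ∘ M))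
  at′ (j , e) = Maybe.map (j ,_) (at (M j) e)

  onto′ : ∀ j v (d : Fin 3 → End (M j)) → (∀ e → at (M j) e ≡ just v → ∃ λ i → d i ≡ e) →
          (e : Σ (Fin n) (End ∘ M)) →
          at′ e ≡ just (j , v) → ∃ λ i → (j , d i) ≡ e
  onto′ j v d onto (k , e) eq with at (M k) e in at≡
  onto′ j v d onto (.j , e) refl | just .v = let i , di≡e = onto e at≡ in i , cong (j ,_) di≡e

-- For every j : J, the free ends s j and t j are identified and the two edges
-- they belong to become one edge.  The last hypothesis says that no edge has
-- both of its ends among the identified ones.
module Junction (M : Multipole) {J : Set} (finiteJ : Finite J) (s t : J → End M)
  (free : ∀ a → Free M ([ s , t ]′ a))
  (inj : Injective _≡_ _≡_ [ s , t ]′)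
  (noEdge : ∀ a b → other M ([ s , t ]′ a) ≢ [ s , t ]′ b)
  where

  joined : J ⊎ J → End M
  joined = [ s , t ]′

  Joined : End M → Set
  Joined e = ∃ λ a → joined a ≡ e

  joined? : Decidable Joined
  joined? e = ∃? (finite-⊎ finiteJ finiteJ) (λ a → _≟_ (finiteEnd M) (joined a) e)

  unjoined? : Decidable (λ e → ¬ Joined e)
  unjoined? e = ¬? (joined? e)

  other-joined : ∀ a → ¬ Joined (other M (joined a))
  other-joined a (b , eq) = noEdge a b (sym eq)

  End′ : Set
  End′ = [ e ∈ End M ∣ ¬ Joined e ]

  resolve : (f : End M) → Dec (Joined f) → End′
  resolve f (yes (a , _)) = other M (joined (swap a)) , [ other-joined (swap a) ]
  resolve f (no ¬p)       = f , [ ¬p ]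

  other′ : End′ → End′
  other′ e = resolve (other M (value e)) (joined? (other M (value e)))

  resolve-joined : ∀ a f (q : Dec (Joined f)) → joined a ≡ f →
                   value (resolve f q) ≡ other M (joined (swap a))
  resolve-joined a f (yes (b , eq)) a≡ =
    cong (λ c → other M (joined (swap c))) (inj {b} {a} (trans eq (sym a≡)))
  resolve-joined a f (no ¬p) a≡ = contradiction (a , a≡) ¬p

  resolve-unjoined : ∀ f (q : Dec (Joined f)) → .(¬ Joined f) → value (resolve f q) ≡ f
  resolve-unjoined f (yes p) ¬p = contradiction p (¬-recompute ¬p)
  resolve-unjoined f (no _)  _  = refl

  swap-≢ : (a : J ⊎ J) → swap a ≢ a
  swap-≢ (inj₁ _) ()
  swap-≢ (inj₂ _) ()

  other′-involutive : ∀ e → other′ (other′ e) ≡ e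
  other′-involutive (e , [ p ]) = value-injective unjoined? (go (joined? (other M e)))
    where
    go : (q : Dec (Joined (other M e))) → value (other′ (resolve (other M e) q)) ≡ e
    go (yes (a , eq)) = trans
      (resolve-joined (swap a) _ (joined? _) (sym (other-involutive M _)))
      (trans (cong (other M ∘ joined) (swap-involutive a))
             (trans (cong (other M) eq) (other-involutive M e)))
    go (no _) = trans
      (resolve-unjoined _ (joined? _) (λ q → p (subst Joined (other-involutive M e) q)))
      (other-involutive M e)

  other′-≢ : ∀ e → other′ e ≢ e
  other′-≢ (e , _) eq = go (joined? (other M e)) (cong value eq)
    where
    go : (q : Dec (Joined (other M e))) → value (resolve (other M e) q) ≢ e
    go (yes (a , a≡)) eq′ = swap-≢ a (inj {swap a} {a} (other-injective M
      (trans eq′ (sym (trans (cong (other M) a≡) (other-involutive M e))))))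
    go (no _) eq′ = other-≢ M e eq′

  junction : Multipole
  junction = record
    { V = V M
    ; End = End′
    ; finiteV = finiteV M
    ; finiteEnd = finite-refinement unjoined? (finiteEnd M)
    ; other = other′
    ; other-involutive = other′-involutive
    ; other-≢ = other′-≢
    ; at = λ e → at M (value e)
    ; cubic = λ v →
        let d , d-inj , d-at , onto = cubic M v in
        (λ i → d i , [ (λ (a , eq) → contradiction
            (trans (sym (d-at i)) (trans (cong (at M) (sym eq)) (free a))) λ ()) ])
        , (λ eq → d-inj (cong value eq))
        , d-at
        , (λ e eq → let i , di≡e = onto (value e) eq in i , value-injective unjoined? di≡e)
    }

open Junction using (junction)

-- The new vertex is nothing : Maybe (V M).
module AddVertex (M : Multipole) (r : Fin 3 → End M)
  (free : ∀ j → Free M (r j)) (inj : Injective _≡_ _≡_ r)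
  where

  isR? : ∀ e → Dec (∃ λ j → r j ≡ e)
  isR? e = ∃? (finite-Fin 3) (λ j → _≟_ (finiteEnd M) (r j) e)

  at′ : (e : End M) → Dec (∃ λ j → r j ≡ e) → Maybe (Maybe (V M))
  at′ e (yes _) = just nothing
  at′ e (no _)  = Maybe.map just (at M e)

  at-r : ∀ j q → at′ (r j) q ≡ just nothing
  at-r j (yes _) = refl
  at-r j (no ¬p) = contradiction (j , refl) ¬p

  at-old : ∀ e v q → at M e ≡ just v → at′ e q ≡ just (just v)
  at-old e v (yes (j , refl)) eq = contradiction (trans (sym eq) (free j)) λ ()
  at-old e v (no _) eq = cong (Maybe.map just) eq

  at-new⁻ : ∀ e q → at′ e q ≡ just nothing → ∃ λ j → r j ≡ e
  at-new⁻ e (yes p) _ = p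
  at-new⁻ e (no _) eq with at M e
  at-new⁻ e (no _) () | just _
  at-new⁻ e (no _) () | nothing

  at-old⁻ : ∀ e v q → at′ e q ≡ just (just v) → at M e ≡ just v
  at-old⁻ e v (no _) eq with at M e
  at-old⁻ e v (no _) refl | just _ = refl

  cubic′ : (v : Maybe (V M)) → ExactlyThree (λ e → at′ e (isR? e) ≡ just v)
  cubic′ nothing  = r , inj , (λ j → at-r j (isR? (r j))) , (λ e → at-new⁻ e (isR? e))
  cubic′ (just v) =
    let d , d-inj , d-at , onto = cubic M v in
    d , d-inj
    , (λ i → at-old (d i) v (isR? (d i)) (d-at i))
    , (λ e eq → onto e (at-old⁻ e v (isR? e) eq))

  addVertex : Multipole
  addVertex = record
    { V = Maybe (V M)
    ; End = End M
    ; finiteV = finite-Maybe (finiteV M)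
    ; finiteEnd = finiteEnd M
    ; other = other M
    ; other-involutive = other-involutive M
    ; other-≢ = other-≢ M
    ; at = λ e → at′ e (isR? e)
    ; cubic = cubic′
    }

open AddVertex using (addVertex)

ℤ₂×ℤ₂ : Set
ℤ₂×ℤ₂ = Bool × Bool

_⊕_ : ℤ₂×ℤ₂ → ℤ₂×ℤ₂ → ℤ₂×ℤ₂
_⊕_ = zip _xor_ _xor_

𝕂 : List ℤ₂×ℤ₂
𝕂 = (false , true) ∷ (true , false) ∷ (true , true) ∷ []

record Colouring (M : Multipole) : Set where
  field
    colour       : End M → ℤ₂×ℤ₂
    colour∈𝕂     : ∀ e → colour e ∈ 𝕂
    colour-other : ∀ e → colour (other M e) ≡ colour e
    proper       : ∀ v e f → at M e ≡ just v → at M f ≡ just v → e ≢ f → colour e ≢ colour f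

open Colouring

IsGraph : Multipole → Set
IsGraph M = ∀ e → ¬ Free M e

Connected : Multipole → Set
Connected M = ∀ x y → Star (Adjacent M) x y

record IsSnark (G : Multipole) : Set where
  field
    isGraph      : IsGraph G
    connected    : Connected G
    uncolourable : ¬ Colouring G

record IsBicriticalSnark (G : Multipole) : Set where
  field
    isSnark    : IsSnark G
    bicritical : ∀ x y → x ≢ y → Colouring (deletePair G x y)

next : ∀ {n} → Fin n → Fin n
next {suc n} i = suc (toℕ i) mod suc n

-- A cycle of length suc n; loops are cycles of length 1 and pairs of parallel
-- edges are cycles of length 2.  That step i ≢ step j for i ≢ j follows from
-- the distinctness of the vertices, so edges-distinct only has to exclude an
-- edge that is traversed in both directions.
record Cycle (M : Multipole) (n : ℕ) : Set where
  field
    vertex         : Fin (suc n) → V M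
    step           : Fin (suc n) → End M
    source         : ∀ i → at M (step i) ≡ just (vertex i)
    target         : ∀ i → at M (other M (step i)) ≡ just (vertex (next i))
    distinct       : Injective _≡_ _≡_ vertex
    edges-distinct : ∀ i j → step i ≢ other M (step j)

GirthAtLeast : ℕ → Multipole → Set
GirthAtLeast g M = ∀ n → Cycle M n → g ≤ suc n

record Negator : Set₁ where
  field
    H       : Multipole
    isSnark : IsSnark H
    girth≥5 : GirthAtLeast 5 H

    -- The path u w v; uw is the end at u of the edge joining u to w, and vw
    -- the end at v of the edge joining v to w.
    u w v   : V H
    u≢w     : u ≢ w
    w≢v     : w ≢ v
    u≢v     : u ≢ v
    uw vw   : End H
    at-uw   : at H uw ≡ just u
    at-wu   : at H (other H uw) ≡ just w
    at-vw   : at H vw ≡ just v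
    at-wv   : at H (other H vw) ≡ just w

    -- The remaining ends at u, at v and at w.
    iᴴ oᴴ   : Fin 2 → End H
    rᴴ      : End H
    iᴴ-inj  : Injective _≡_ _≡_ iᴴ
    oᴴ-inj  : Injective _≡_ _≡_ oᴴ
    at-iᴴ   : ∀ k → at H (iᴴ k) ≡ just u
    at-oᴴ   : ∀ k → at H (oᴴ k) ≡ just v
    at-rᴴ   : at H rᴴ ≡ just w
    iᴴ≢uw   : ∀ k → iᴴ k ≢ uw
    oᴴ≢vw   : ∀ k → oᴴ k ≢ vw
    rᴴ≢wu   : rᴴ ≢ other H uw
    rᴴ≢wv   : rᴴ ≢ other H vw

  OnPath : V H → Set
  OnPath z = z ≡ u ⊎ z ≡ w ⊎ z ≡ v

  onPath? : Decidable OnPath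
  onPath? z = _≟_ (finiteV H) z u ⊎-dec (_≟_ (finiteV H) z w ⊎-dec _≟_ (finiteV H) z v)

  PathEnd : End H → Set
  PathEnd e = (e ≡ uw ⊎ e ≡ other H uw) ⊎ (e ≡ vw ⊎ e ≡ other H vw)

  pathEnd? : Decidable PathEnd
  pathEnd? e = (_≟_ (finiteEnd H) e uw ⊎-dec _≟_ (finiteEnd H) e (other H uw))
    ⊎-dec (_≟_ (finiteEnd H) e vw ⊎-dec _≟_ (finiteEnd H) e (other H vw))

  free-onPath : ∀ e {z} → at H e ≡ just z → OnPath z → Free (delete H onPath?) e
  free-onPath e {z} eq p rewrite eq with onPath? z
  ... | yes _ = refl
  ... | no ¬p = contradiction p ¬p

  free-pathEnd : ∀ e → PathEnd e → Free (delete H onPath?) e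
  free-pathEnd e (inj₁ (inj₁ refl)) = free-onPath _ at-uw (inj₁ refl)
  free-pathEnd e (inj₁ (inj₂ refl)) = free-onPath _ at-wu (inj₂ (inj₁ refl))
  free-pathEnd e (inj₂ (inj₁ refl)) = free-onPath _ at-vw (inj₂ (inj₂ refl))
  free-pathEnd e (inj₂ (inj₂ refl)) = free-onPath _ at-wv (inj₂ (inj₁ refl))

  pathEnd-closed : ∀ e → PathEnd (other H e) → PathEnd e
  pathEnd-closed e (inj₁ (inj₁ eq)) =
    inj₁ (inj₂ (trans (sym (other-involutive H e)) (cong (other H) eq)))
  pathEnd-closed e (inj₁ (inj₂ eq)) = inj₁ (inj₁ (other-injective H eq))
  pathEnd-closed e (inj₂ (inj₁ eq)) =
    inj₂ (inj₂ (trans (sym (other-involutive H e)) (cong (other H) eq)))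
  pathEnd-closed e (inj₂ (inj₂ eq)) = inj₂ (inj₁ (other-injective H eq))

  pole : Multipole
  pole = discard (delete H onPath?) pathEnd? free-pathEnd pathEnd-closed

  ends-≢ : ∀ {x y e f} → x ≢ y → at H e ≡ just x → at H f ≡ just y → e ≢ f
  ends-≢ x≢y ex fy refl = x≢y (just-injective (trans (sym ex) fy))

  iᴴ-kept : ∀ k → ¬ PathEnd (iᴴ k)
  iᴴ-kept k (inj₁ (inj₁ eq)) = iᴴ≢uw k eq
  iᴴ-kept k (inj₁ (inj₂ eq)) = ends-≢ u≢w (at-iᴴ k) at-wu eq
  iᴴ-kept k (inj₂ (inj₁ eq)) = ends-≢ u≢v (at-iᴴ k) at-vw eq
  iᴴ-kept k (inj₂ (inj₂ eq)) = ends-≢ u≢w (at-iᴴ k) at-wv eq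

  oᴴ-kept : ∀ k → ¬ PathEnd (oᴴ k)
  oᴴ-kept k (inj₁ (inj₁ eq)) = ends-≢ u≢v at-uw (at-oᴴ k) (sym eq)
  oᴴ-kept k (inj₁ (inj₂ eq)) = ends-≢ w≢v at-wu (at-oᴴ k) (sym eq)
  oᴴ-kept k (inj₂ (inj₁ eq)) = oᴴ≢vw k eq
  oᴴ-kept k (inj₂ (inj₂ eq)) = ends-≢ w≢v at-wv (at-oᴴ k) (sym eq)

  rᴴ-kept : ¬ PathEnd rᴴ
  rᴴ-kept (inj₁ (inj₁ eq)) = ends-≢ u≢w at-uw at-rᴴ (sym eq)
  rᴴ-kept (inj₁ (inj₂ eq)) = rᴴ≢wu eq
  rᴴ-kept (inj₂ (inj₁ eq)) = ends-≢ w≢v at-rᴴ at-vw eq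
  rᴴ-kept (inj₂ (inj₂ eq)) = rᴴ≢wv eq

  i o : Fin 2 → End pole
  i k = iᴴ k , [ iᴴ-kept k ]
  o k = oᴴ k , [ oᴴ-kept k ]

  r : End pole
  r = rᴴ , [ rᴴ-kept ]

  free-i : ∀ k → Free pole (i k)
  free-i k = free-onPath _ (at-iᴴ k) (inj₁ refl)

  free-o : ∀ k → Free pole (o k)
  free-o k = free-onPath _ (at-oᴴ k) (inj₂ (inj₂ refl))

  free-r : Free pole r
  free-r = free-onPath _ at-rᴴ (inj₂ (inj₁ refl))

  no-loop : ∀ {x} e → at H e ≡ just x → at H (other H e) ≢ just x
  no-loop {x} e ex fx with girth≥5 0 (record
    { vertex = λ _ → x
    ; step = λ _ → e
    ; source = λ _ → ex
    ; target = λ _ → fx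
    ; distinct = λ { {zero} {zero} _ → refl }
    ; edges-distinct = λ _ _ eq → other-≢ H e (sym eq)
    })
  ... | s≤s ()

  no-chord : ∀ e → at H e ≡ just v → at H (other H e) ≢ just u
  no-chord e ev eu = contradiction (girth≥5 2 (record
    { vertex = vertex
    ; step = step
    ; source = source
    ; target = target
    ; distinct = λ {a} {b} → distinct a b
    ; edges-distinct = λ a b eq → no-return a b
        (distinct a (next b) (just-injective
          (trans (sym (source a)) (trans (cong (at H) eq) (target b)))))
        (distinct b (next a) (just-injective (trans (sym (source b))
          (trans (cong (at H) (sym (trans (cong (other H) eq) (other-involutive H _)))) (target a)))))
    })) λ { (s≤s (s≤s (s≤s ()))) }
    where
    vertex : Fin 3 → V H
    vertex zero             = u
    vertex (suc zero)       = w
    vertex (suc (suc zero)) = v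

    step : Fin 3 → End H
    step zero             = uw
    step (suc zero)       = other H vw
    step (suc (suc zero)) = e

    source : ∀ a → at H (step a) ≡ just (vertex a)
    source zero             = at-uw
    source (suc zero)       = at-wv
    source (suc (suc zero)) = ev

    target : ∀ a → at H (other H (step a)) ≡ just (vertex (next a))
    target zero             = at-wu
    target (suc zero)       = trans (cong (at H) (other-involutive H vw)) at-vw
    target (suc (suc zero)) = eu

    distinct : ∀ a b → vertex a ≡ vertex b → a ≡ b
    distinct zero             zero             _  = refl
    distinct zero             (suc zero)       eq = contradiction eq u≢w
    distinct zero             (suc (suc zero)) eq = contradiction eq u≢v
    distinct (suc zero)       zero             eq = contradiction (sym eq) u≢w
    distinct (suc zero)       (suc zero)       _  = refl
    distinct (suc zero)       (suc (suc zero)) eq = contradiction eq w≢v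
    distinct (suc (suc zero)) zero             eq = contradiction (sym eq) u≢v
    distinct (suc (suc zero)) (suc zero)       eq = contradiction (sym eq) w≢v
    distinct (suc (suc zero)) (suc (suc zero)) _  = refl

    no-return : (a b : Fin 3) → a ≡ next b → b ≢ next a
    no-return _ zero             refl ()
    no-return _ (suc zero)       refl ()
    no-return _ (suc (suc zero)) refl ()

  no-joined-edge : ∀ (a b : Fin 2 ⊎ Fin 2) → other pole ([ i , o ]′ a) ≢ [ i , o ]′ b
  no-joined-edge (inj₁ k) (inj₁ l) eq =
    no-loop (iᴴ k) (at-iᴴ k) (trans (cong (at H ∘ value) eq) (at-iᴴ l))
  no-joined-edge (inj₁ k) (inj₂ l) eq =
    no-chord (oᴴ l) (at-oᴴ l) (trans (cong (at H)
      (trans (cong (other H) (sym (cong value eq))) (other-involutive H (iᴴ k)))) (at-iᴴ k))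
  no-joined-edge (inj₂ k) (inj₁ l) eq =
    no-chord (oᴴ k) (at-oᴴ k) (trans (cong (at H ∘ value) eq) (at-iᴴ l))
  no-joined-edge (inj₂ k) (inj₂ l) eq =
    no-loop (oᴴ k) (at-oᴴ k) (trans (cong (at H ∘ value) eq) (at-oᴴ l))

  -- The values of a colouring of pole, or of a multipole obtained from pole by
  -- deleting vertices, at (i₁, i₂, o₁, o₂, r).
  boundary : (End pole → ℤ₂×ℤ₂) → Vec ℤ₂×ℤ₂ 5
  boundary φ = φ (i zero) ∷ φ (i (suc zero)) ∷ φ (o zero) ∷ φ (o (suc zero)) ∷ φ r ∷ []

PerfectTuple : Pred (Vec ℤ₂×ℤ₂ 5) _
PerfectTuple τ = ∃ λ z → ∃ λ a → ∃ λ b → z ∈ 𝕂 × a ∈ 𝕂 × b ∈ 𝕂 × a ≢ b ×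
  (τ ≡ z ∷ z ∷ a ∷ b ∷ (a ⊕ b) ∷ [] ⊎ τ ≡ a ∷ b ∷ z ∷ z ∷ (a ⊕ b) ∷ [])

Perfect : Negator → Set
Perfect N = ∀ τ → (∃ λ (φ : Colouring pole) → boundary (colour φ) ≡ τ) ⇔ PerfectTuple τ
  where open Negator N

record Feasible (N : Negator) : Set where
  open Negator N
  field
    colourable : (x y : V pole) → x ≢ y → Colouring (deletePair H (value x) (value y))
    monochromatic : ∀ x → x ≡ u ⊎ x ≡ v → (y : V pole) →
      let H-xy = deletePair H x (value y) in
      ∀ e f → e ≢ f → at H e ≡ just x → at H f ≡ just x →
      Dangling H-xy e → Dangling H-xy f →
      ∃ λ (φ : Colouring H-xy) → colour φ e ≡ colour φ f
    transmitting : (y : V pole) →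
      ∃ λ a → ∃ λ b → a ∈ 𝕂 × b ∈ 𝕂 × a ≢ b ×
      (∃ λ (φ : Colouring (deleteVertex pole y)) → boundary (colour φ) ≡ a ∷ a ∷ b ∷ b ∷ a ∷ []) ×
      (∃ λ (ψ : Colouring (deleteVertex pole y)) → boundary (colour ψ) ≡ a ∷ a ∷ b ∷ b ∷ b ∷ [])

-- The negators are arranged cyclically by next : Fin 3 → Fin 3; σ j is the
-- bijection along which the junction of O_j with I_(next j) is performed.
module _ (N : Fin 3 → Negator) (σ : Fin 3 → Permutation′ 2) where

  private
    module N j = Negator (N j)

  poles : Multipole
  poles = ∐ N.pole

  outs ins : Fin 3 × Fin 2 → End poles
  outs (j , k) = j , N.o j k
  ins  (j , k) = next j , N.i (next j) (σ j ⟨$⟩ʳ k)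

  free-joined : ∀ a → Free poles ([ outs , ins ]′ a)
  free-joined (inj₁ (j , k)) = cong (Maybe.map (j ,_)) (N.free-o j k)
  free-joined (inj₂ (j , k)) = cong (Maybe.map (next j ,_)) (N.free-i (next j) (σ j ⟨$⟩ʳ k))

  next-injective : (j k : Fin 3) → next j ≡ next k → j ≡ k
  next-injective zero             zero             _ = refl
  next-injective zero             (suc zero)       ()
  next-injective zero             (suc (suc zero)) ()
  next-injective (suc zero)       zero             ()
  next-injective (suc zero)       (suc zero)       _ = refl
  next-injective (suc zero)       (suc (suc zero)) ()
  next-injective (suc (suc zero)) zero             ()
  next-injective (suc (suc zero)) (suc zero)       ()
  next-injective (suc (suc zero)) (suc (suc zero)) _ = refl

  i≢o : ∀ j {k l} → N.i j k ≢ N.o j l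
  i≢o j {k} {l} eq = N.ends-≢ j (N.u≢v j) (N.at-iᴴ j k) (N.at-oᴴ j l) (cong value eq)

  r≢i : ∀ j {k} → N.r j ≢ N.i j k
  r≢i j {k} eq = N.ends-≢ j (N.u≢w j) (N.at-iᴴ j k) (N.at-rᴴ j) (sym (cong value eq))

  r≢o : ∀ j {k} → N.r j ≢ N.o j k
  r≢o j {k} eq = N.ends-≢ j (N.w≢v j) (N.at-rᴴ j) (N.at-oᴴ j k) (cong value eq)

  tags : {a b : Fin 3} {x : End (N.pole a)} {y : End (N.pole b)} →
         _≡_ {A = End poles} (a , x) (b , y) → a ≡ b
  tags refl = refl

  injective-joined : Injective _≡_ _≡_ [ outs , ins ]′
  injective-joined {inj₁ (j , k)} {inj₁ (j′ , k′)} eq with refl ← tags eq =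
    cong (λ l → inj₁ (j , l)) (N.oᴴ-inj j (cong value (inj-tag eq)))
  injective-joined {inj₁ (j , k)} {inj₂ (j′ , k′)} eq with refl ← tags eq =
    contradiction (sym (inj-tag eq)) (i≢o (next j′))
  injective-joined {inj₂ (j , k)} {inj₁ (j′ , k′)} eq with refl ← tags eq =
    contradiction (inj-tag eq) (i≢o (next j))
  injective-joined {inj₂ (j , k)} {inj₂ (j′ , k′)} eq with refl ← next-injective j j′ (tags eq) =
    cong (λ l → inj₂ (j , l))
      (Injection.injective (↔⇒↣ (σ j)) (N.iᴴ-inj (next j) (cong value (inj-tag eq))))

  no-edge-joined : ∀ a b → other poles ([ outs , ins ]′ a) ≢ [ outs , ins ]′ b
  no-edge-joined (inj₁ (j , k)) (inj₁ (j′ , k′)) eq with refl ← tags eq =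
    N.no-joined-edge j (inj₂ k) (inj₂ k′) (inj-tag eq)
  no-edge-joined (inj₁ (j , k)) (inj₂ (j′ , k′)) eq with refl ← tags eq =
    N.no-joined-edge j (inj₂ k) (inj₁ _) (inj-tag eq)
  no-edge-joined (inj₂ (j , k)) (inj₁ (j′ , k′)) eq with refl ← tags eq =
    N.no-joined-edge (next j) (inj₁ _) (inj₂ k′) (inj-tag eq)
  no-edge-joined (inj₂ (j , k)) (inj₂ (j′ , k′)) eq with refl ← next-injective j j′ (tags eq) =
    N.no-joined-edge (next j) (inj₁ _) (inj₁ _) (inj-tag eq)

  ring : Multipole
  ring = junction poles (finite-Σ (finite-Fin 3) (λ _ → finite-Fin 2)) outs ins
    free-joined injective-joined no-edge-joined

  residual-unjoined : ∀ j → ¬ ∃ λ a → [ outs , ins ]′ a ≡ (j , N.r j)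
  residual-unjoined j (inj₁ (j′ , k) , eq) with refl ← tags eq = r≢o j (sym (inj-tag eq))
  residual-unjoined j (inj₂ (j′ , k) , eq) with refl ← tags eq = r≢i j (sym (inj-tag eq))

  residual : Fin 3 → End ring
  residual j = (j , N.r j) , [ residual-unjoined j ]

  NNN : Multipole
  NNN = addVertex ring residual
    (λ j → cong (Maybe.map (j ,_)) (N.free-r j))
    (λ eq → tags (cong value eq))

{-# OPTIONS --safe #-}
module Submission where

-- In a perfect negator exactly one of the connectors I and O is monochromatic,
-- so a colouring of G would alternate around a ring of odd length.  For
-- connectedness, rotating the three colours on a single component of a pole
-- again gives a colouring; the boundaries admitted by perfection are not
-- preserved unless that component contains the neighbour of r, so every vertex
-- of G is joined to the new vertex.  For bicriticality, write (I | O) for the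
-- colours of a pole, where c ≠ d and e ≠ f:
--   * new vertex and y: (a a | z z) on N − y, then (z z | c d), (c d | a a);
--   * x, y in one pole: restrict a colouring (c d | e f) of H − {x , y}, then
--     (e f | z z), (z z | c d); the vertices u, w, v force distinct residuals;
--   * x, y in consecutive poles: (z z | c d) on the second, from a colouring of
--     H − {u , y}, and then (c d | a a) on the third determine the residual
--     colour t wanted on the first; condition (ii), after permuting the
--     colours, provides (a a | z z) with residual t for arbitrary z and t.

open import Defs
open import Data.Bool using (Bool; true; false; _xor_; if_then_else_)
import Data.Bool.Properties as Bool
open import Data.Empty using (⊥)
open import Data.Fin using (Fin; zero; suc)
open import Data.Fin.Permutation using (Permutation′; _⟨$⟩ʳ_; _⟨$⟩ˡ_; inverseˡ; inverseʳ; flip)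
import Data.Fin.Permutation as Permutation
import Data.Fin.Properties as Fin
open import Data.Irrelevant using ([_])
open import Data.List using (List; []; _∷_)
open import Data.List.Membership.Propositional using (_∈_)
open import Data.List.Relation.Unary.All using (all?; lookup; tabulate)
open import Data.List.Relation.Unary.Any using (here; there)
open import Data.Maybe using (just; nothing; _>>=_; Is-just)
import Data.Maybe as Maybe
open import Data.Maybe.Properties using (just-injective)
import Data.Maybe.Properties as Maybe
import Data.Maybe.Relation.Unary.Any as MaybeAny
open import Data.Nat using (s≤s)
open import Data.Product using (∃; _×_; _,_; proj₁; proj₂)
import Data.Product.Properties as Product
open import Data.Refinement using (_,_; value)
open import Data.Sum using (_⊎_; inj₁; inj₂; [_,_]′; swap)
import Data.Sum as Sum
open import Data.Unit using (tt)
open import Data.Vec using ([]; _∷_)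
import Data.Vec as Vec
open import Function using (_∘_; mk⇔; const; id; Injective; Equivalence)
open import Relation.Binary using (DecidableEquality)
open import Relation.Binary.Construct.Closure.ReflexiveTransitive using (Star; ε; _◅_; _◅◅_; gmap; reverse)
open import Relation.Binary.PropositionalEquality using (_≡_; _≢_; refl; sym; trans; cong; cong₂; subst; ≢-sym)
open import Relation.Nullary using (¬_; Dec; yes; no; does; contradiction; ¬?)
open import Relation.Nullary.Decidable using (_⊎-dec_; _×-dec_; _→-dec_; map′; from-yes; dec-true; dec-false; does-⇔)
open import Relation.Nullary.Recomputable using (¬-recompute)
open import Relation.Unary using (Decidable)

open Finite
open Multipole

-- Colours

_≟ᶜ_ : DecidableEquality ℤ₂×ℤ₂
_≟ᶜ_ = Product.≡-dec Bool._≟_ Bool._≟_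

-- Quantifiers over the three colours are decidable, so identities between sums of colours can be
-- proved by evaluation with `from-yes`.
∀𝕂? : {P : ℤ₂×ℤ₂ → Set} → (∀ c → Dec (P c)) → Dec (∀ {c} → c ∈ 𝕂 → P c)
∀𝕂? P? = map′ lookup tabulate (all? P? 𝕂)

∃𝕂? : {P : ℤ₂×ℤ₂ → Set} → (∀ c → Dec (P c)) → Dec (∃ λ c → c ∈ 𝕂 × P c)
∃𝕂? {P} P? = map′ to from ((P? (false , true)) ⊎-dec (P? (true , false) ⊎-dec P? (true , true)))
  where
  to : P (false , true) ⊎ P (true , false) ⊎ P (true , true) → ∃ λ c → c ∈ 𝕂 × P c
  to (inj₁ p)        = _ , here refl , p
  to (inj₂ (inj₁ p)) = _ , there (here refl) , p
  to (inj₂ (inj₂ p)) = _ , there (there (here refl)) , p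

  from : (∃ λ c → c ∈ 𝕂 × P c) → P (false , true) ⊎ P (true , false) ⊎ P (true , true)
  from (_ , here refl , p)                 = inj₁ p
  from (_ , there (here refl) , p)         = inj₂ (inj₁ p)
  from (_ , there (there (here refl)) , p) = inj₂ (inj₂ p)

third-colour : ∀ {a} → a ∈ 𝕂 → ∀ {b} → b ∈ 𝕂 → ∀ {c} → c ∈ 𝕂 → a ≢ b → c ≢ a → c ≢ b → c ≡ a ⊕ b
third-colour = from-yes (∀𝕂? λ a → ∀𝕂? λ b → ∀𝕂? λ c →
  ¬? (a ≟ᶜ b) →-dec ¬? (c ≟ᶜ a) →-dec ¬? (c ≟ᶜ b) →-dec (c ≟ᶜ (a ⊕ b)))

⊕∈𝕂 : ∀ {a} → a ∈ 𝕂 → ∀ {b} → b ∈ 𝕂 → a ≢ b → (a ⊕ b) ∈ 𝕂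
⊕∈𝕂 (here refl)                 (here refl)                 a≢b = contradiction refl a≢b
⊕∈𝕂 (here refl)                 (there (here refl))         _   = there (there (here refl))
⊕∈𝕂 (here refl)                 (there (there (here refl))) _   = there (here refl)
⊕∈𝕂 (there (here refl))         (here refl)                 _   = there (there (here refl))
⊕∈𝕂 (there (here refl))         (there (here refl))         a≢b = contradiction refl a≢b
⊕∈𝕂 (there (here refl))         (there (there (here refl))) _   = here refl
⊕∈𝕂 (there (there (here refl))) (here refl)                 _   = there (here refl)
⊕∈𝕂 (there (there (here refl))) (there (here refl))         _   = here refl
⊕∈𝕂 (there (there (here refl))) (there (there (here refl))) a≢b = contradiction refl a≢b

⊕-≢ˡ : ∀ {a} → a ∈ 𝕂 → ∀ {b} → b ∈ 𝕂 → a ⊕ b ≢ a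
⊕-≢ˡ = from-yes (∀𝕂? λ a → ∀𝕂? λ b → ¬? ((a ⊕ b) ≟ᶜ a))

⊕-≢ʳ : ∀ {a} → a ∈ 𝕂 → ∀ {b} → b ∈ 𝕂 → a ⊕ b ≢ b
⊕-≢ʳ = from-yes (∀𝕂? λ a → ∀𝕂? λ b → ¬? ((a ⊕ b) ≟ᶜ b))

⊕-comm : ∀ a b → a ⊕ b ≡ b ⊕ a
⊕-comm (a , b) (c , d) = cong₂ _,_ (Bool.xor-comm a c) (Bool.xor-comm b d)

another-colour : ∀ c → ∃ λ a → a ∈ 𝕂 × a ≢ c
another-colour (false , _) = (true , true) , there (there (here refl)) , λ ()
another-colour (true  , _) = (false , true) , here refl , λ ()

-- Injectivity is asked for on `𝕂` only: `send` below also maps the non-colour (0,0) to `a′ ⊕ b′`,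
-- the image of the third colour.
record IsRecolouring (π : ℤ₂×ℤ₂ → ℤ₂×ℤ₂) : Set where
  field
    closed    : ∀ {c} → c ∈ 𝕂 → π c ∈ 𝕂
    injective : ∀ {c d} → c ∈ 𝕂 → d ∈ 𝕂 → π c ≡ π d → c ≡ d

module _ (a b a′ b′ : ℤ₂×ℤ₂) where

  -- For colours `a ≢ b` and `a′ ≢ b′` this is the only permutation of `𝕂` taking `a` to `a′` and
  -- `b` to `b′`, because the third colour is always the sum of the other two.
  send : ℤ₂×ℤ₂ → ℤ₂×ℤ₂
  send c with c ≟ᶜ a | c ≟ᶜ b
  ... | yes _ | _     = a′
  ... | no _  | yes _ = b′
  ... | no _  | no _  = a′ ⊕ b′

  send-a : send a ≡ a′
  send-a with a ≟ᶜ a | a ≟ᶜ b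
  ... | yes _   | _ = refl
  ... | no a≢a  | _ = contradiction refl a≢a

  send-b : a ≢ b → send b ≡ b′
  send-b a≢b with b ≟ᶜ a | b ≟ᶜ b
  ... | yes b≡a | _      = contradiction (sym b≡a) a≢b
  ... | no _    | yes _  = refl
  ... | no _    | no b≢b = contradiction refl b≢b

  send-isRecolouring : a ∈ 𝕂 → b ∈ 𝕂 → a ≢ b → a′ ∈ 𝕂 → b′ ∈ 𝕂 → a′ ≢ b′ → IsRecolouring send
  send-isRecolouring a∈ b∈ a≢b a′∈ b′∈ a′≢b′ = record { closed = λ {c} _ → closed c ; injective = injective }
    where
    closed : ∀ c → send c ∈ 𝕂
    closed c with c ≟ᶜ a | c ≟ᶜ b
    ... | yes _ | _     = a′∈
    ... | no _  | yes _ = b′∈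
    ... | no _  | no _  = ⊕∈𝕂 a′∈ b′∈ a′≢b′

    injective : ∀ {c d} → c ∈ 𝕂 → d ∈ 𝕂 → send c ≡ send d → c ≡ d
    injective {c} {d} c∈ d∈ eq with c ≟ᶜ a | c ≟ᶜ b | d ≟ᶜ a | d ≟ᶜ b
    ... | yes refl | _        | yes refl | _        = refl
    ... | yes _    | _        | no _     | yes _    = contradiction eq a′≢b′
    ... | yes _    | _        | no _     | no _     = contradiction (sym eq) (⊕-≢ˡ a′∈ b′∈)
    ... | no _     | yes _    | yes _    | _        = contradiction (sym eq) a′≢b′
    ... | no _     | yes refl | no _     | yes refl = refl
    ... | no _     | yes _    | no _     | no _     = contradiction (sym eq) (⊕-≢ʳ a′∈ b′∈)
    ... | no _     | no _     | yes _    | _        = contradiction eq (⊕-≢ˡ a′∈ b′∈)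
    ... | no _     | no _     | no _     | yes _    = contradiction eq (⊕-≢ʳ a′∈ b′∈)
    ... | no c≢a   | no c≢b   | no d≢a   | no d≢b   =
      trans (third-colour a∈ b∈ c∈ a≢b c≢a c≢b) (sym (third-colour a∈ b∈ d∈ a≢b d≢a d≢b))

-- The linear map that cycles (0,1), (1,0), (1,1) and so fixes no colour.
rotate : ℤ₂×ℤ₂ → ℤ₂×ℤ₂
rotate (a , b) = a xor b , a

rotate-isRecolouring : IsRecolouring rotate
rotate-isRecolouring = record { closed = closed ; injective = λ c∈ d∈ → injective c∈ d∈ }
  where
  closed : ∀ {c} → c ∈ 𝕂 → rotate c ∈ 𝕂
  closed (here refl)                 = there (here refl)
  closed (there (here refl))         = there (there (here refl))
  closed (there (there (here refl))) = here refl

  injective : ∀ {c} → c ∈ 𝕂 → ∀ {d} → d ∈ 𝕂 → rotate c ≡ rotate d → c ≡ d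
  injective = from-yes (∀𝕂? λ c → ∀𝕂? λ d → (rotate c ≟ᶜ rotate d) →-dec (c ≟ᶜ d))

turn : Bool → ℤ₂×ℤ₂ → ℤ₂×ℤ₂
turn b c = if b then rotate c else c

turn-isRecolouring : ∀ b → IsRecolouring (turn b)
turn-isRecolouring false = record { closed = id ; injective = λ _ _ eq → eq }
turn-isRecolouring true  = rotate-isRecolouring

-- Colourings

-- φ colours the multipole obtained from M by deleting the vertices in D.
record IsColouring (M : Multipole) (D : V M → Set) (φ : End M → ℤ₂×ℤ₂) : Set where
  field
    in-𝕂   : ∀ e → φ e ∈ 𝕂
    along  : ∀ e → φ (other M e) ≡ φ e
    proper : ∀ v → ¬ D v → ∀ {e f} → at M e ≡ just v → at M f ≡ just v → e ≢ f → φ e ≢ φ f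

open IsColouring
open IsRecolouring

weaken : ∀ {M φ} {D D′ : V M → Set} → (∀ {v} → D v → D′ v) → IsColouring M D φ → IsColouring M D′ φ
weaken D⊆D′ c = record { in-𝕂 = in-𝕂 c ; along = along c ; proper = λ v ¬D′v → proper c v (¬D′v ∘ D⊆D′) }

recoloured : ∀ {M D φ π} → IsRecolouring π → IsColouring M D φ → IsColouring M D (π ∘ φ)
recoloured {π = π} p c = record
  { in-𝕂   = λ e → closed p (in-𝕂 c e)
  ; along  = λ e → cong π (along c e)
  ; proper = λ v ¬Dv ev fv e≢f eq → proper c v ¬Dv ev fv e≢f (injective p (in-𝕂 c _) (in-𝕂 c _) eq)
  }

colouring⇒ : ∀ {M} (φ : Colouring M) → IsColouring M (const ⊥) (Colouring.colour φ)
colouring⇒ φ = record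
  { in-𝕂 = colour∈𝕂 ; along = colour-other ; proper = λ v _ → proper′ v _ _ }
  where open Colouring φ renaming (proper to proper′)

module _ (M : Multipole) {P : V M → Set} (P? : Decidable P) where

  at-delete⁺ : ∀ e {v} .(p : ¬ P v) → at M e ≡ just v → at (delete M P?) e ≡ just (v , [ p ])
  at-delete⁺ e {v} p eq = trans (cong (_>>= refine? _) eq) (refine?-just (¬? ∘ P?) v p)

  at-delete⁻ : ∀ e {v} → at (delete M P?) e ≡ just v → at M e ≡ just (value v)
  at-delete⁻ e eq with at M e
  ... | just x = cong just (sym (refine?-value (¬? ∘ P?) eq))

  free-delete⁺ : ∀ e {v} → P v → at M e ≡ just v → Free (delete M P?) e
  free-delete⁺ e {v} p eq rewrite eq with P? v
  ... | yes _ = refl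
  ... | no ¬p = contradiction p ¬p

  free-delete⁻ : ∀ e {v} → at M e ≡ just v → Free (delete M P?) e → P v
  free-delete⁻ e {v} eq free with P? v
  ... | yes p = p
  ... | no ¬p = contradiction (trans (sym (at-delete⁺ e ¬p eq)) free) λ ()

  colouring-delete⁺ : ∀ {φ} → IsColouring M P φ → Colouring (delete M P?)
  colouring-delete⁺ {φ} c = record
    { colour       = φ
    ; colour∈𝕂     = in-𝕂 c
    ; colour-other = along c
    ; proper       = λ { (v , [ ¬p ]) e f ev fv →
        proper c v (¬-recompute ¬p) (at-delete⁻ e ev) (at-delete⁻ f fv) }
    }

  colouring-delete⁻ : (φ : Colouring (delete M P?)) → IsColouring M P (Colouring.colour φ)
  colouring-delete⁻ φ = record
    { in-𝕂 = colour∈𝕂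
    ; along = colour-other
    ; proper = λ v ¬p {e} {f} ev fv → proper′ (v , [ ¬p ]) e f (at-delete⁺ e ¬p ev) (at-delete⁺ f ¬p fv)
    }
    where open Colouring φ renaming (proper to proper′)

module _ (M : Multipole) (e : End M) (c : ℤ₂×ℤ₂) where

  private
    OnEdge : End M → Set
    OnEdge f = f ≡ e ⊎ f ≡ other M e

    onEdge? : Decidable OnEdge
    onEdge? f = _≟_ (finiteEnd M) f e ⊎-dec _≟_ (finiteEnd M) f (other M e)

  recolourEdge : (End M → ℤ₂×ℤ₂) → End M → ℤ₂×ℤ₂
  recolourEdge φ f = if does (onEdge? f) then c else φ f

  recolourEdge-on : ∀ φ → recolourEdge φ e ≡ c
  recolourEdge-on φ rewrite dec-true (onEdge? e) (inj₁ refl) = refl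

  recolourEdge-off : ∀ φ {f} → f ≢ e → f ≢ other M e → recolourEdge φ f ≡ φ f
  recolourEdge-off φ {f} f≢e f≢e′ rewrite dec-false (onEdge? f) [ f≢e , f≢e′ ]′ = refl

  -- Properness only constrains ends at surviving vertices, and each end of this edge is free or at
  -- a deleted vertex.
  recolourEdge-isColouring : ∀ {D φ} → c ∈ 𝕂 →
    (∀ {v} → at M e ≡ just v → D v) → (∀ {v} → at M (other M e) ≡ just v → D v) →
    IsColouring M D φ → IsColouring M D (recolourEdge φ)
  recolourEdge-isColouring {D} {φ} c∈ dead dead′ φ-col = record
    { in-𝕂 = ∈𝕂
    ; along = λ f → cong₂ (λ b d → if b then c else d)
        (does-⇔ (mk⇔ (closed-on f) (closed-on′ f)) (onEdge? (other M f)) (onEdge? f)) (along φ-col f)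
    ; proper = λ v ¬Dv ev fv e≢f eq → proper φ-col v ¬Dv ev fv e≢f
        (trans (sym (unchanged ¬Dv ev)) (trans eq (unchanged ¬Dv fv)))
    }
    where
    ∈𝕂 : ∀ f → recolourEdge φ f ∈ 𝕂
    ∈𝕂 f with does (onEdge? f)
    ... | true  = c∈
    ... | false = in-𝕂 φ-col f

    closed-on : ∀ f → OnEdge (other M f) → OnEdge f
    closed-on f (inj₁ eq) = inj₂ (trans (sym (other-involutive M f)) (cong (other M) eq))
    closed-on f (inj₂ eq) = inj₁ (other-injective M eq)

    closed-on′ : ∀ f → OnEdge f → OnEdge (other M f)
    closed-on′ f (inj₁ eq) = inj₂ (cong (other M) eq)
    closed-on′ f (inj₂ eq) = inj₁ (trans (cong (other M) eq) (other-involutive M e))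

    unchanged : ∀ {v f} → ¬ D v → at M f ≡ just v → recolourEdge φ f ≡ φ f
    unchanged ¬Dv fv = recolourEdge-off φ (λ { refl → ¬Dv (dead fv) }) (λ { refl → ¬Dv (dead′ fv) })

-- Disjoint unions, junctions and added vertices

module _ {n} (M : Fin n → Multipole) where

  at-∐⁻ : ∀ {j v} (e : End (∐ M)) → at (∐ M) e ≡ just (j , v) →
          ∃ λ e′ → e ≡ (j , e′) × at (M j) e′ ≡ just v
  at-∐⁻ (k , e) eq with at (M k) e in at≡
  at-∐⁻ (k , e) refl | just _ = e , refl , at≡

  ∐-isColouring : ∀ {D} {φ : ∀ j → End (M j) → ℤ₂×ℤ₂} →
    (∀ j → IsColouring (M j) (λ v → D (j , v)) (φ j)) → IsColouring (∐ M) D (λ (j , e) → φ j e)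
  ∐-isColouring {D} {φ} c = record
    { in-𝕂   = λ (j , e) → in-𝕂 (c j) e
    ; along  = λ (j , e) → along (c j) e
    ; proper = λ (j , v) → proper′ j v
    }
    where
    proper′ : ∀ j v → ¬ D (j , v) → ∀ {e f} → at (∐ M) e ≡ just (j , v) → at (∐ M) f ≡ just (j , v) →
              e ≢ f → φ (proj₁ e) (proj₂ e) ≢ φ (proj₁ f) (proj₂ f)
    proper′ j v ¬Dv {e} {f} ev fv e≢f with at-∐⁻ e ev | at-∐⁻ f fv
    ... | e′ , refl , ev′ | f′ , refl , fv′ = proper (c j) v ¬Dv ev′ fv′ (e≢f ∘ cong (j ,_))

  ∐-component : ∀ {φ} → IsColouring (∐ M) (const ⊥) φ → ∀ j → IsColouring (M j) (const ⊥) (λ e → φ (j , e))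
  ∐-component c j = record
    { in-𝕂   = λ e → in-𝕂 c (j , e)
    ; along  = λ e → along c (j , e)
    ; proper = λ v ¬⊥ ev fv e≢f →
        proper c (j , v) ¬⊥ (cong (Maybe.map (j ,_)) ev) (cong (Maybe.map (j ,_)) fv) (e≢f ∘ inj-tag)
    }

module JunctionProperties (M : Multipole) {J : Set} (finiteJ : Finite J) (s t : J → End M)
  (free : ∀ a → Free M ([ s , t ]′ a))
  (inj : Injective _≡_ _≡_ [ s , t ]′)
  (noEdge : ∀ a b → other M ([ s , t ]′ a) ≢ [ s , t ]′ b)
  where

  open module J = Junction M finiteJ s t free inj noEdge public using (joined; Joined; joined?; unjoined?; resolve; junction)

  attached-unjoined : ∀ {e v} → at M e ≡ just v → ¬ Joined e
  attached-unjoined ev (a , refl) = contradiction (trans (sym ev) (free a)) λ ()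

  -- By `match` the colour passes unchanged across every identified pair, so each merged edge still
  -- has a single colour.
  junction-isColouring : ∀ {D φ} → (∀ k → φ (s k) ≡ φ (t k)) →
    IsColouring M D φ → IsColouring junction D (φ ∘ value)
  junction-isColouring {D} {φ} match c = record
    { in-𝕂   = λ e → in-𝕂 c (value e)
    ; along  = λ e → trans (resolved (other M (value e)) (joined? (other M (value e)))) (along c (value e))
    ; proper = λ v ¬Dv ev fv e≢f → proper c v ¬Dv ev fv (e≢f ∘ value-injective unjoined?)
    }
    where
    match′ : ∀ a → φ (joined (swap a)) ≡ φ (joined a)
    match′ (inj₁ k) = sym (match k)
    match′ (inj₂ k) = match k

    resolved : ∀ f (q : Dec (Joined f)) → φ (value (resolve f q)) ≡ φ f
    resolved f (yes (a , refl)) = trans (along c _) (match′ a)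
    resolved f (no _)           = refl

  -- A joined end takes the colour of the edge that absorbed it.
  unjoin : (End junction → ℤ₂×ℤ₂) → End M → ℤ₂×ℤ₂
  unjoin φ e = colour (joined? e)
    where
    colour : Dec (Joined e) → ℤ₂×ℤ₂
    colour (yes (a , _)) = φ (other M (joined a) , [ J.other-joined a ])
    colour (no ¬p)          = φ (e , [ ¬p ])

  unjoin-joined : ∀ φ a → unjoin φ (joined a) ≡ φ (other M (joined a) , [ J.other-joined a ])
  unjoin-joined φ a with joined? (joined a)
  ... | yes (b , eq) = cong (λ c → φ (other M (joined c) , [ J.other-joined c ])) (inj {b} {a} eq)
  ... | no ¬p        = contradiction (a , refl) ¬p

  unjoin-unjoined : ∀ φ e .(¬p : ¬ Joined e) → unjoin φ e ≡ φ (e , [ ¬p ])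
  unjoin-unjoined φ e ¬p with joined? e
  ... | yes p = contradiction p (¬-recompute ¬p)
  ... | no _  = refl

  unjoin-isColouring : ∀ {φ} → IsColouring junction (const ⊥) φ → IsColouring M (const ⊥) (unjoin φ)
  unjoin-isColouring {φ} c = record
    { in-𝕂   = ∈𝕂
    ; along  = λ e → along′ e (joined? e) (joined? (other M e))
    ; proper = λ v ¬⊥ {e} {f} ev fv e≢f eq → proper c v ¬⊥
        {e , [ attached-unjoined ev ]} {f , [ attached-unjoined fv ]} ev fv (e≢f ∘ cong value)
        (trans (sym (unjoin-unjoined φ e (attached-unjoined ev))) (trans eq (unjoin-unjoined φ f (attached-unjoined fv))))
    }
    where
    ∈𝕂 : ∀ e → unjoin φ e ∈ 𝕂
    ∈𝕂 e with joined? e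
    ... | yes (a , refl) = in-𝕂 c _
    ... | no _           = in-𝕂 c _

    along′ : ∀ e → Dec (Joined e) → Dec (Joined (other M e)) → unjoin φ (other M e) ≡ unjoin φ e
    along′ e (yes (a , refl)) _ =
      trans (unjoin-unjoined φ _ (J.other-joined a)) (sym (unjoin-joined φ a))
    -- The end opposite to `e` is joined, so `unjoin` gives it the colour of `e` itself.
    along′ e (no ¬p) (yes (a , eq)) = trans (cong (unjoin φ) (sym eq)) (trans (unjoin-joined φ a)
      (trans (cong φ (value-injective unjoined? (trans (cong (other M) eq) (other-involutive M e))))
             (sym (unjoin-unjoined φ e ¬p))))
    along′ e (no ¬p) (no ¬q) = trans (unjoin-unjoined φ _ ¬q)
      (trans (cong φ (value-injective unjoined? (sym (J.resolve-unjoined _ (joined? _) ¬q))))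
        (trans (along c (e , [ ¬p ])) (sym (unjoin-unjoined φ e ¬p))))

  -- The far ends of `s k` and `t k` are the two ends of one edge of the junction, and both joined
  -- ends take the colour of that edge.
  unjoin-match : ∀ {φ} → IsColouring junction (const ⊥) φ → ∀ k → unjoin φ (s k) ≡ unjoin φ (t k)
  unjoin-match {φ} c k = trans (unjoin-joined φ (inj₁ k)) (trans (sym (along c _))
    (trans (cong φ (value-injective unjoined?
             (J.resolve-joined (inj₁ k) _ (joined? _) (sym (other-involutive M (s k))))))
           (sym (unjoin-joined φ (inj₂ k)))))

  at-other-junction : ∀ e {v} → at M (other M (value e)) ≡ just v → at junction (other junction e) ≡ just v
  at-other-junction e ev =
    trans (cong (at M) (J.resolve-unjoined _ (joined? _) (attached-unjoined ev))) ev

  adjacent-junction : ∀ {x y} → Adjacent M x y → Adjacent junction x y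
  adjacent-junction (e , ex , ey) = e′ , ex , at-other-junction e′ ey
    where
    e′ : End junction
    e′ = e , [ attached-unjoined ex ]

module AddVertexProperties (M : Multipole) (r : Fin 3 → End M)
  (free : ∀ j → Free M (r j)) (inj : Injective _≡_ _≡_ r)
  where

  open module A = AddVertex M r free inj public using (addVertex; isR?)

  -- Distinct colours at the new vertex are required only if it survives, so the lemma also covers
  -- its deletion.
  addVertex-isColouring : ∀ {D φ} → (¬ D nothing → Injective _≡_ _≡_ (φ ∘ r)) →
    IsColouring M (D ∘ just) φ → IsColouring addVertex D φ
  addVertex-isColouring {D} {φ} distinct c = record
    { in-𝕂 = in-𝕂 c ; along = along c ; proper = proper′ }
    where
    proper′ : ∀ v → ¬ D v → ∀ {e f} → at addVertex e ≡ just v → at addVertex f ≡ just v → e ≢ f → φ e ≢ φ f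
    proper′ (just v) ¬Dv {e} {f} ev fv = proper c v ¬Dv (A.at-old⁻ e v (isR? e) ev) (A.at-old⁻ f v (isR? f) fv)
    proper′ nothing ¬D {e} {f} ev fv e≢f eq
      with i , refl ← A.at-new⁻ e (isR? e) ev | j , refl ← A.at-new⁻ f (isR? f) fv =
      e≢f (cong r (distinct ¬D eq))

  addVertex-old : ∀ {φ} → IsColouring addVertex (const ⊥) φ → IsColouring M (const ⊥) φ
  addVertex-old c = record
    { in-𝕂   = in-𝕂 c
    ; along  = along c
    ; proper = λ v ¬⊥ {e} {f} ev fv →
        proper c (just v) ¬⊥ (A.at-old e v (isR? e) ev) (A.at-old f v (isR? f) fv)
    }

  adjacent-addVertex : ∀ {x y} → Adjacent M x y → Adjacent addVertex (just x) (just y)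
  adjacent-addVertex (e , ex , ey) = e , A.at-old e _ (isR? e) ex , A.at-old _ _ (isR? _) ey

  adjacent-new : ∀ j {y} → at M (other M (r j)) ≡ just y → Adjacent addVertex nothing (just y)
  adjacent-new j ey = r j , A.at-r j (isR? (r j)) , A.at-old _ _ (isR? _) ey

Adjacent-sym : ∀ M {x y} → Adjacent M x y → Adjacent M y x
Adjacent-sym M (e , ex , ey) = other M e , ey , trans (cong (at M) (other-involutive M e)) ex

-- Reachability

module _ {A : Set} (F : Finite A) {R : A → A → Set} (R? : ∀ x y → Dec (R x y)) where

  -- As in the Floyd–Warshall algorithm, all inner vertices of the path are in the list.
  Via : List A → A → A → Set
  Via []       x y = x ≡ y ⊎ R x y
  Via (m ∷ ms) x y = Via ms x y ⊎ (Via ms x m × Via ms m y)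

  via? : ∀ ms x y → Dec (Via ms x y)
  via? []       x y = _≟_ F x y ⊎-dec R? x y
  via? (m ∷ ms) x y = via? ms x y ⊎-dec (via? ms x m ×-dec via? ms m y)

  via-sound : ∀ ms {x y} → Via ms x y → Star R x y
  via-sound []       (inj₁ refl)    = ε
  via-sound []       (inj₂ xRy)     = xRy ◅ ε
  via-sound (m ∷ ms) (inj₁ p)       = via-sound ms p
  via-sound (m ∷ ms) (inj₂ (p , q)) = via-sound ms p ◅◅ via-sound ms q

  via-short : ∀ ms {x y} → x ≡ y ⊎ R x y → Via ms x y
  via-short []       p = p
  via-short (m ∷ ms) p = inj₁ (via-short ms p)

  via-trans : ∀ ms {x m y} → m ∈ ms → Via ms x m → Via ms m y → Via ms x y
  -- Closed walks at `m` are cut off both paths.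
  via-trans (m ∷ ms) (here refl) p q = inj₂ ([ id , proj₁ ]′ p , [ id , proj₂ ]′ q)
  via-trans (_ ∷ ms) (there m∈) (inj₁ p)       (inj₁ q)         = inj₁ (via-trans ms m∈ p q)
  via-trans (_ ∷ ms) (there m∈) (inj₁ p)       (inj₂ (q , q′))  = inj₂ (via-trans ms m∈ p q , q′)
  via-trans (_ ∷ ms) (there m∈) (inj₂ (p , p′)) (inj₁ q)        = inj₂ (p , via-trans ms m∈ p′ q)
  -- Both paths pass through the head of the list; the detour from it through `m` and back is
  -- dropped.
  via-trans (_ ∷ ms) (there m∈) (inj₂ (p , _)) (inj₂ (_ , q′))  = inj₂ (p , q′)

  via-complete : ∀ {x y} → Star R x y → Via (elements F) x y
  via-complete ε          = via-short (elements F) (inj₁ refl)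
  via-complete (xRm ◅ p) =
    via-trans (elements F) (complete F _) (via-short (elements F) (inj₂ xRm)) (via-complete p)

  -- Deciding reachability makes the recolouring of one component an actual function on ends.
  star? : ∀ x y → Dec (Star R x y)
  star? x y = map′ (via-sound (elements F)) via-complete (via? (elements F) x y)

module _ (M : Multipole) where

  at? : ∀ e v → Dec (at M e ≡ just v)
  at? e v = Maybe.≡-dec (_≟_ (finiteV M)) (at M e) (just v)

  adjacent? : ∀ x y → Dec (Adjacent M x y)
  adjacent? x y = ∃? (finiteEnd M) (λ e → at? e x ×-dec at? (other M e) y)

-- Rotating the colours on one component

module Component (M : Multipole) (x : V M) where

  -- Either end of the edge may witness contact, so the free end of a dangling edge belongs to the
  -- component of its attached end.
  Touches : End M → Set
  Touches e = ∃ λ v → Star (Adjacent M) x v × (at M e ≡ just v ⊎ at M (other M e) ≡ just v)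

  touches? : Decidable Touches
  touches? e = ∃? (finiteV M) λ v →
    star? (finiteV M) (adjacent? M) x v ×-dec (at? M e v ⊎-dec at? M (other M e) v)

  turned : (End M → ℤ₂×ℤ₂) → End M → ℤ₂×ℤ₂
  turned φ e = turn (does (touches? e)) (φ e)

  -- The two ends of an edge, and likewise the ends at a vertex, are all in the component or all
  -- outside it, so one permutation acts on each of these sets.
  turned-isColouring : ∀ {φ} → IsColouring M (const ⊥) φ → IsColouring M (const ⊥) (turned φ)
  turned-isColouring {φ} c = record
    { in-𝕂   = λ e → closed (turn-isRecolouring (does (touches? e))) (in-𝕂 c e)
    ; along  = λ e → cong₂ turn
        (does-⇔ (mk⇔ (flip-end e) (unflip-end e)) (touches? (other M e)) (touches? e)) (along c e)
    ; proper = λ v ¬⊥ {e} {f} ev fv e≢f eq → proper c v ¬⊥ ev fv e≢f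
        (injective (turn-isRecolouring (does (touches? e))) (in-𝕂 c e) (in-𝕂 c f)
          (trans eq (cong (λ b → turn b (φ f))
            (does-⇔ (mk⇔ (transfer fv ev) (transfer ev fv)) (touches? f) (touches? e)))))
    }
    where
    unflip-end : ∀ e → Touches e → Touches (other M e)
    unflip-end e (v , xv , inj₁ ev) = v , xv , inj₂ (trans (cong (at M) (other-involutive M e)) ev)
    unflip-end e (v , xv , inj₂ ev) = v , xv , inj₁ ev

    flip-end : ∀ e → Touches (other M e) → Touches e
    flip-end e = subst Touches (other-involutive M e) ∘ unflip-end (other M e)

    transfer : ∀ {e f v} → at M e ≡ just v → at M f ≡ just v → Touches e → Touches f
    transfer {e} {f} {v} ev fv (v′ , xv′ , inj₁ ev′) =
      v , subst (Star _ x) (just-injective (trans (sym ev′) ev)) xv′ , inj₁ fv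
    transfer {e} {f} {v} ev fv (v′ , xv′ , inj₂ ev′) =
      v , xv′ ◅◅ (Adjacent-sym M (e , ev , ev′) ◅ ε) , inj₁ fv

-- Negators

exhaust-Fin3 : (i j k l : Fin 3) → i ≢ j → i ≢ k → j ≢ k → l ≡ i ⊎ l ≡ j ⊎ l ≡ k
exhaust-Fin3 = from-yes (Fin.all? λ (i : Fin 3) → Fin.all? λ (j : Fin 3) → Fin.all? λ (k : Fin 3) → Fin.all? λ (l : Fin 3) →
  ¬? (i Fin.≟ j) →-dec ¬? (i Fin.≟ k) →-dec ¬? (j Fin.≟ k) →-dec
  ((l Fin.≟ i) ⊎-dec ((l Fin.≟ j) ⊎-dec (l Fin.≟ k))))

exhaust-three : {A : Set} {P : A → Set} → ExactlyThree P → ∀ {a b c} → P a → P b → P c →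
  a ≢ b → a ≢ c → b ≢ c → ∀ {e} → P e → e ≡ a ⊎ e ≡ b ⊎ e ≡ c
exhaust-three (d , _ , _ , onto) Pa Pb Pc a≢b a≢c b≢c Pe
  with i , refl ← onto _ Pa | j , refl ← onto _ Pb | k , refl ← onto _ Pc | l , refl ← onto _ Pe =
  Sum.map (cong d) (Sum.map (cong d) (cong d))
    (exhaust-Fin3 i j k l (a≢b ∘ cong d) (a≢c ∘ cong d) (b≢c ∘ cong d))

attached : ∀ {M} → IsGraph M → ∀ e → ∃ λ v → at M e ≡ just v
attached {M} graph e with at M e in eq
... | just v  = v , refl
... | nothing = contradiction eq (graph e)

0≢1 : _≢_ {A = Fin 2} zero (suc zero)
0≢1 ()

-- `PerfectTuple` without its existential witnesses, hence decidable and usable in a search over all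
-- boundaries.
Shape : (i₁ i₂ o₁ o₂ r : ℤ₂×ℤ₂) → Set
Shape i₁ i₂ o₁ o₂ r = (i₁ ≡ i₂ × o₁ ≢ o₂ × r ≡ o₁ ⊕ o₂) ⊎ (o₁ ≡ o₂ × i₁ ≢ i₂ × r ≡ i₁ ⊕ i₂)

shape? : ∀ i₁ i₂ o₁ o₂ r → Dec (Shape i₁ i₂ o₁ o₂ r)
shape? i₁ i₂ o₁ o₂ r = (i₁ ≟ᶜ i₂ ×-dec ¬? (o₁ ≟ᶜ o₂) ×-dec r ≟ᶜ (o₁ ⊕ o₂))
                 ⊎-dec (o₁ ≟ᶜ o₂ ×-dec ¬? (i₁ ≟ᶜ i₂) ×-dec r ≟ᶜ (i₁ ⊕ i₂))

shape⁺ : ∀ {i₁ i₂ o₁ o₂ r} → PerfectTuple (i₁ ∷ i₂ ∷ o₁ ∷ o₂ ∷ r ∷ []) → Shape i₁ i₂ o₁ o₂ r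
shape⁺ (_ , _ , _ , _ , _ , _ , a≢b , inj₁ refl) = inj₁ (refl , a≢b , refl)
shape⁺ (_ , _ , _ , _ , _ , _ , a≢b , inj₂ refl) = inj₂ (refl , a≢b , refl)

shape-resp : ∀ {i₁ i₂ o₁ o₂ r i₁′ i₂′ o₁′ o₂′ r′} → i₁ ≡ i₁′ → i₂ ≡ i₂′ → o₁ ≡ o₁′ → o₂ ≡ o₂′ → r ≡ r′ →
             Shape i₁ i₂ o₁ o₂ r → Shape i₁′ i₂′ o₁′ o₂′ r′
shape-resp refl refl refl refl refl s = s

pair : ℤ₂×ℤ₂ → ℤ₂×ℤ₂ → Fin 2 → ℤ₂×ℤ₂
pair a b zero       = a
pair a b (suc zero) = b

pair∈ : ∀ {a b} → a ∈ 𝕂 → b ∈ 𝕂 → ∀ k → pair a b k ∈ 𝕂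
pair∈ a∈ b∈ zero       = a∈
pair∈ a∈ b∈ (suc zero) = b∈

total : (Fin 2 → ℤ₂×ℤ₂) → ℤ₂×ℤ₂
total α = α zero ⊕ α (suc zero)

∀Bool? : {P : Bool → Set} → (∀ b → Dec (P b)) → Dec (∀ b → P b)
∀Bool? P? = map′ (λ { (f , t) false → f ; (f , t) true → t }) (λ p → p false , p true) (P? false ×-dec P? true)

-- The flags tell which ends of I and O are rotated while `r` stays fixed. Evaluation finds, for
-- each pattern with some flag set, an admissible boundary that this destroys.
spoil : ∀ b₁ b₂ b₃ b₄ → (b₁ ≡ false × b₂ ≡ false × b₃ ≡ false × b₄ ≡ false) ⊎
  (∃ λ i₁ → i₁ ∈ 𝕂 × ∃ λ i₂ → i₂ ∈ 𝕂 × ∃ λ o₁ → o₁ ∈ 𝕂 × ∃ λ o₂ → o₂ ∈ 𝕂 × ∃ λ r → r ∈ 𝕂 ×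
    Shape i₁ i₂ o₁ o₂ r × ¬ Shape (turn b₁ i₁) (turn b₂ i₂) (turn b₃ o₁) (turn b₄ o₂) r)
spoil = from-yes (∀Bool? λ b₁ → ∀Bool? λ b₂ → ∀Bool? λ b₃ → ∀Bool? λ b₄ →
  (b₁ Bool.≟ false ×-dec b₂ Bool.≟ false ×-dec b₃ Bool.≟ false ×-dec b₄ Bool.≟ false) ⊎-dec
  (∃𝕂? λ i₁ → ∃𝕂? λ i₂ → ∃𝕂? λ o₁ → ∃𝕂? λ o₂ → ∃𝕂? λ r →
    shape? i₁ i₂ o₁ o₂ r ×-dec ¬? (shape? (turn b₁ i₁) (turn b₂ i₂) (turn b₃ o₁) (turn b₄ o₂) r)))

-- The connector colours are functions on `Fin 2`, so that they compose with the bijections of the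
-- junctions.
record Coloured (N : Negator) (D : V (Negator.pole N) → Set) (α ω : Fin 2 → ℤ₂×ℤ₂) (ρ : ℤ₂×ℤ₂) : Set where
  open Negator N
  field
    φ           : End pole → ℤ₂×ℤ₂
    isColouring : IsColouring pole D φ
    φ-i         : ∀ k → φ (i k) ≡ α k
    φ-o         : ∀ k → φ (o k) ≡ ω k
    φ-r         : φ r ≡ ρ

weaken-coloured : ∀ {N D D′ α ω ρ} → (∀ {v} → D v → D′ v) → Coloured N D α ω ρ → Coloured N D′ α ω ρ
weaken-coloured D⊆D′ c = record
  { φ = φ ; isColouring = weaken D⊆D′ isColouring ; φ-i = φ-i ; φ-o = φ-o ; φ-r = φ-r }
  where open Coloured c

permuted : ∀ {N D α ω ρ α′ ω′ ρ′} π → IsRecolouring π →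
  (∀ k → π (α k) ≡ α′ k) → (∀ k → π (ω k) ≡ ω′ k) → π ρ ≡ ρ′ → Coloured N D α ω ρ → Coloured N D α′ ω′ ρ′
permuted π p α≡ ω≡ ρ≡ c = record
  { φ = π ∘ φ
  ; isColouring = recoloured p isColouring
  ; φ-i = λ k → trans (cong π (φ-i k)) (α≡ k)
  ; φ-o = λ k → trans (cong π (φ-o k)) (ω≡ k)
  ; φ-r = trans (cong π φ-r) ρ≡
  }
  where open Coloured c

module NegatorProperties (N : Negator) where
  open Negator N

  private
    module H = IsSnark isSnark

  no-parallel : ∀ {x y e f} → e ≢ f → at H e ≡ just x → at H f ≡ just x →
                at H (other H e) ≡ just y → at H (other H f) ≢ just y
  no-parallel {x} {y} {e} {f} e≢f ex fx ey fy = contradiction (girth≥5 1 (record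
    { vertex = vertex
    ; step = step
    ; source = λ { zero → ex ; (suc zero) → fy }
    ; target = λ { zero → ey ; (suc zero) → trans (cong (at H) (other-involutive H f)) fx }
    ; distinct = λ {a} {b} → distinct a b
    ; edges-distinct = edges-distinct
    })) λ { (s≤s (s≤s ())) }
    where
    x≢y : x ≢ y
    x≢y refl = no-loop e ex ey

    vertex : Fin 2 → V H
    vertex zero       = x
    vertex (suc zero) = y

    step : Fin 2 → End H
    step zero       = e
    step (suc zero) = other H f

    distinct : ∀ a b → vertex a ≡ vertex b → a ≡ b
    distinct zero       zero       _  = refl
    distinct zero       (suc zero) eq = contradiction eq x≢y
    distinct (suc zero) zero       eq = contradiction (sym eq) x≢y
    distinct (suc zero) (suc zero) _  = refl

    edges-distinct : ∀ a b → step a ≢ other H (step b)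
    edges-distinct zero       zero       eq = other-≢ H e (sym eq)
    edges-distinct zero       (suc zero) eq = e≢f (trans eq (other-involutive H f))
    edges-distinct (suc zero) zero       eq = e≢f (sym (other-injective H eq))
    edges-distinct (suc zero) (suc zero) eq = other-≢ H (other H f) (sym eq)

  at-pole⁻ : ∀ e {v} → at pole e ≡ just v → at H (value e) ≡ just (value v)
  at-pole⁻ e = at-delete⁻ H onPath? (value e)

  -- As `H` has no free ends, a free end of the pole was at `u`, `w` or `v`. The three ends at each
  -- of these vertices are known, and those on the two path edges have been discarded.
  free-pole : ∀ e → Free pole e → (∃ λ k → e ≡ i k) ⊎ (∃ λ k → e ≡ o k) ⊎ e ≡ r
  free-pole (e , [ kept ]) free with attached {H} H.isGraph e
  ... | x , ex with free-delete⁻ H onPath? e ex free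
  ...   | inj₁ refl with exhaust-three (cubic H u) at-uw (at-iᴴ zero) (at-iᴴ (suc zero))
                           (≢-sym (iᴴ≢uw zero)) (≢-sym (iᴴ≢uw (suc zero))) (0≢1 ∘ iᴴ-inj) ex
  ...     | inj₁ refl        = contradiction (inj₁ (inj₁ refl)) (¬-recompute kept)
  ...     | inj₂ (inj₁ refl) = inj₁ (zero , refl)
  ...     | inj₂ (inj₂ refl) = inj₁ (suc zero , refl)
  free-pole (e , [ kept ]) free | x , ex | inj₂ (inj₂ refl)
    with exhaust-three (cubic H v) at-vw (at-oᴴ zero) (at-oᴴ (suc zero))
           (≢-sym (oᴴ≢vw zero)) (≢-sym (oᴴ≢vw (suc zero))) (0≢1 ∘ oᴴ-inj) ex
  ...     | inj₁ refl        = contradiction (inj₂ (inj₁ refl)) (¬-recompute kept)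
  ...     | inj₂ (inj₁ refl) = inj₂ (inj₁ (zero , refl))
  ...     | inj₂ (inj₂ refl) = inj₂ (inj₁ (suc zero , refl))
  free-pole (e , [ kept ]) free | x , ex | inj₂ (inj₁ refl)
    with exhaust-three (cubic H w) at-rᴴ at-wu at-wv rᴴ≢wu rᴴ≢wv
           (λ eq → ends-≢ u≢v at-uw at-vw (other-injective H eq)) ex
  ...     | inj₁ refl        = inj₂ (inj₂ refl)
  ...     | inj₂ (inj₁ refl) = contradiction (inj₁ (inj₂ refl)) (¬-recompute kept)
  ...     | inj₂ (inj₂ refl) = contradiction (inj₂ (inj₂ refl)) (¬-recompute kept)

  restrict : ∀ {D φ} → IsColouring H D φ → IsColouring pole (D ∘ value) (φ ∘ value)
  restrict c = record
    { in-𝕂   = λ e → in-𝕂 c (value e)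
    ; along  = λ e → along c (value e)
    ; proper = λ v ¬Dv {e} {f} ev fv e≢f →
        proper c (value v) ¬Dv (at-pole⁻ e ev) (at-pole⁻ f fv) (e≢f ∘ value-injective (¬? ∘ pathEnd?))
    }

  coloured : ∀ {D φ} α ω {ρ} → IsColouring pole D φ →
    boundary φ ≡ α zero ∷ α (suc zero) ∷ ω zero ∷ ω (suc zero) ∷ ρ ∷ [] → Coloured N D α ω ρ
  coloured {φ = φ} α ω c eq = record
    { φ = φ
    ; isColouring = c
    ; φ-i = λ { zero → cong Vec.head eq ; (suc zero) → cong (Vec.head ∘ Vec.tail) eq }
    ; φ-o = λ { zero       → cong (Vec.head ∘ Vec.tail ∘ Vec.tail) eq
              ; (suc zero) → cong (Vec.head ∘ Vec.tail ∘ Vec.tail ∘ Vec.tail) eq }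
    ; φ-r = cong (Vec.head ∘ Vec.tail ∘ Vec.tail ∘ Vec.tail ∘ Vec.tail) eq
    }

  module _ {D φ} (c : IsColouring H D φ) where

    -- At a surviving vertex each colour is the sum of the other two. Applied to `u`, `v` and `w`,
    -- this expresses the colours of the path edges through the boundary of the pole.
    sum-at-w : ¬ D w → φ uw ≢ φ vw × φ rᴴ ≡ φ uw ⊕ φ vw
    sum-at-w ¬Dw = uw≢vw , third-colour (in-𝕂 c uw) (in-𝕂 c vw) (in-𝕂 c rᴴ) uw≢vw
      (λ eq → proper c w ¬Dw at-rᴴ at-wu rᴴ≢wu (trans eq (sym (along c uw))))
      (λ eq → proper c w ¬Dw at-rᴴ at-wv rᴴ≢wv (trans eq (sym (along c vw))))
      where
      uw≢vw : φ uw ≢ φ vw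
      uw≢vw eq = proper c w ¬Dw at-wu at-wv (ends-≢ u≢v at-uw at-vw ∘ other-injective H)
        (trans (along c uw) (trans eq (sym (along c vw))))

    sum-at-u : ¬ D u → φ (iᴴ zero) ≢ φ (iᴴ (suc zero)) × φ uw ≡ φ (iᴴ zero) ⊕ φ (iᴴ (suc zero))
    sum-at-u ¬Du = i≢ , third-colour (in-𝕂 c _) (in-𝕂 c _) (in-𝕂 c uw) i≢
      (proper c u ¬Du at-uw (at-iᴴ _) (≢-sym (iᴴ≢uw _))) (proper c u ¬Du at-uw (at-iᴴ _) (≢-sym (iᴴ≢uw _)))
      where i≢ = proper c u ¬Du (at-iᴴ _) (at-iᴴ _) (0≢1 ∘ iᴴ-inj)

    sum-at-v : ¬ D v → φ (oᴴ zero) ≢ φ (oᴴ (suc zero)) × φ vw ≡ φ (oᴴ zero) ⊕ φ (oᴴ (suc zero))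
    sum-at-v ¬Dv = o≢ , third-colour (in-𝕂 c _) (in-𝕂 c _) (in-𝕂 c vw) o≢
      (proper c v ¬Dv at-vw (at-oᴴ _) (≢-sym (oᴴ≢vw _))) (proper c v ¬Dv at-vw (at-oᴴ _) (≢-sym (oᴴ≢vw _)))
      where o≢ = proper c v ¬Dv (at-oᴴ _) (at-oᴴ _) (0≢1 ∘ oᴴ-inj)

  off-path : ∀ (y : V pole) {z} → OnPath z → z ≢ value y
  off-path (y , [ ¬p ]) p refl = ¬-recompute ¬p p

  -- Since `u` is not in the pole, the walk has a first step onto the path `u w v`; the edge of that
  -- step dangles in the pole.
  exit : (x : V pole) → Star (Adjacent H) (value x) u →
         ∃ λ y → Star (Adjacent pole) x y × ∃ λ e → at pole e ≡ just y × Free pole (other pole e)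
  exit x p = go x p refl
    where
    go : ∀ (x : V pole) {x′} → Star (Adjacent H) x′ u → x′ ≡ value x →
         ∃ λ y → Star (Adjacent pole) x y × ∃ λ e → at pole e ≡ just y × Free pole (other pole e)
    go x ε eq = contradiction eq (off-path x (inj₁ refl))
    go x@(x′ , [ ¬p ]) (_◅_ {j = y} (e , ex , ey) path) refl = step (onPath? y)
      where
      kept : ¬ PathEnd e
      kept q = contradiction (trans (sym (at-delete⁺ H onPath? e ¬p ex)) (free-pathEnd e q)) λ ()

      e′ : End pole
      e′ = e , [ kept ]

      step : Dec (OnPath y) →
        ∃ λ y → Star (Adjacent pole) x y × ∃ λ e → at pole e ≡ just y × Free pole (other pole e)
      step (yes q) = x , ε , e′ , at-delete⁺ H onPath? e ¬p ex , free-delete⁺ H onPath? (other H e) q ey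
      step (no ¬q) with z , yz , rest ← go (y , [ ¬q ]) path refl =
        z , (e′ , at-delete⁺ H onPath? e ¬p ex , at-delete⁺ H onPath? (other H e) ¬q ey) ◅ yz , rest

  -- Perfect negators

  module _ (perfect : Perfect N) where

    shape : ∀ {φ} → IsColouring pole (const ⊥) φ →
            Shape (φ (i zero)) (φ (i (suc zero))) (φ (o zero)) (φ (o (suc zero))) (φ r)
    shape {φ} c = shape⁺ (Equivalence.to (perfect (boundary φ)) (record
      { colour = φ ; colour∈𝕂 = in-𝕂 c ; colour-other = along c
      ; proper = λ v _ _ → proper c v id } , refl))

    -- Perfection colours the whole pole, and such a colouring remains valid after deleting any set
    -- `D` of vertices.
    realise : ∀ {D α ω ρ} → (∀ k → α k ∈ 𝕂) → (∀ k → ω k ∈ 𝕂) →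
      Shape (α zero) (α (suc zero)) (ω zero) (ω (suc zero)) ρ → Coloured N D α ω ρ
    realise {D} {α} {ω} {ρ} α∈ ω∈ s = let φ , eq = Equivalence.from (perfect _) (tuple s) in
      coloured α ω (weaken (λ ()) (colouring⇒ φ)) eq
      where
      tuple : Shape (α zero) (α (suc zero)) (ω zero) (ω (suc zero)) ρ →
              PerfectTuple (α zero ∷ α (suc zero) ∷ ω zero ∷ ω (suc zero) ∷ ρ ∷ [])
      tuple (inj₁ (α≡ , ω≢ , refl)) = _ , _ , _ , α∈ zero , ω∈ zero , ω∈ (suc zero) , ω≢ ,
        inj₁ (cong (λ a → α zero ∷ a ∷ _) (sym α≡))
      tuple (inj₂ (ω≡ , α≢ , refl)) = _ , _ , _ , ω∈ zero , α∈ zero , α∈ (suc zero) , α≢ ,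
        inj₂ (cong (λ a → α zero ∷ α (suc zero) ∷ ω zero ∷ a ∷ _) (sym ω≡))

    -- If the component of x missed r, rotating the colours on it would turn
    -- some admissible boundary into an inadmissible one.
    reaches-r : (x : V pole) → ∃ λ y → Star (Adjacent pole) x y × at pole (other pole r) ≡ just y
    reaches-r x = conclude (touches? r)
      where
      open Component pole x

      false⇒ : ∀ e → does (touches? e) ≡ false → ¬ Touches e
      false⇒ e eq t = contradiction (trans (sym (dec-true (touches? e) t)) eq) λ ()

      spoiled : ∀ {i₁ i₂ o₁ o₂ ρ} → ¬ Touches r → Coloured N (const ⊥) (pair i₁ i₂) (pair o₁ o₂) ρ →
        Shape (turn (does (touches? (i zero))) i₁) (turn (does (touches? (i (suc zero)))) i₂)
              (turn (does (touches? (o zero))) o₁) (turn (does (touches? (o (suc zero)))) o₂) ρ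
      spoiled ¬t c = shape-resp
        (cong (turn _) (φ-i zero)) (cong (turn _) (φ-i (suc zero)))
        (cong (turn _) (φ-o zero)) (cong (turn _) (φ-o (suc zero)))
        (cong₂ turn (dec-false (touches? r) ¬t) φ-r)
        (shape (turned-isColouring isColouring))
        where open Coloured c

      untouched : ¬ Touches r → (∀ k → ¬ Touches (i k)) × (∀ k → ¬ Touches (o k))
      untouched ¬t = [
        (λ (p , q , p′ , q′) → (λ { zero → false⇒ (i zero) p  ; (suc zero) → false⇒ (i (suc zero)) q })
                             , (λ { zero → false⇒ (o zero) p′ ; (suc zero) → false⇒ (o (suc zero)) q′ })) ,
        (λ (_ , i₁∈ , _ , i₂∈ , _ , o₁∈ , _ , o₂∈ , _ , _ , s , ¬s) →
          contradiction (spoiled ¬t (realise (pair∈ i₁∈ i₂∈) (pair∈ o₁∈ o₂∈) s)) ¬s) ]′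
        (spoil (does (touches? (i zero))) (does (touches? (i (suc zero))))
               (does (touches? (o zero))) (does (touches? (o (suc zero)))))

      -- Such a free end would be touched, but by `free-pole` it lies in I, in O or at `r`, where
      -- nothing is touched.
      stuck : ¬ Touches r →
        ¬ ∃ λ y → Star (Adjacent pole) x y × ∃ λ e → at pole e ≡ just y × Free pole (other pole e)
      stuck ¬t (y , xy , e , ey , free) = [
        (λ (k , eq) → proj₁ (untouched ¬t) k (subst Touches eq t)) ,
        [ (λ (k , eq) → proj₂ (untouched ¬t) k (subst Touches eq t)) , (λ eq → ¬t (subst Touches eq t)) ]′ ]′
        (free-pole (other pole e) free)
        where
        t : Touches (other pole e)
        t = y , xy , inj₂ (trans (cong (at pole) (other-involutive pole e)) ey)

      conclude : Dec (Touches r) → ∃ λ y → Star (Adjacent pole) x y × at pole (other pole r) ≡ just y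
      conclude (yes (y , xy , inj₁ ry)) = contradiction (trans (sym ry) free-r) λ ()
      conclude (yes (y , xy , inj₂ ry)) = y , xy , ry
      conclude (no ¬t)                  = contradiction (exit x (H.connected (value x) u)) (stuck ¬t)

  -- Feasible negators

  module _ (feasible : Feasible N) where
    open Feasible feasible

    -- As `u`, `v` and `w` survive, the totals of I and O are the colours of `uw` and `vw`. These
    -- differ at `w`, where the residual edge takes the third colour.
    colour-pair : (x y : V pole) → x ≢ y →
      ∃ λ α → ∃ λ ω → (∀ k → α k ∈ 𝕂) × (∀ k → ω k ∈ 𝕂) ×
      α zero ≢ α (suc zero) × ω zero ≢ ω (suc zero) × total α ≢ total ω ×
      Coloured N (λ z → z ≡ x ⊎ z ≡ y) α ω (total α ⊕ total ω)
    colour-pair x y x≢y = φ ∘ iᴴ , φ ∘ oᴴ , in-𝕂 c ∘ iᴴ , in-𝕂 c ∘ oᴴ , i≢ , o≢ ,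
      (λ eq → uw≢vw (trans uw≡ (trans eq (sym vw≡)))) , record
        { φ = φ ∘ value
        ; isColouring = weaken (Sum.map (value-injective (¬? ∘ onPath?)) (value-injective (¬? ∘ onPath?))) (restrict c)
        ; φ-i = λ _ → refl
        ; φ-o = λ _ → refl
        ; φ-r = trans r≡ (cong₂ _⊕_ uw≡ vw≡)
        }
      where
      φ = Colouring.colour (colourable x y x≢y)

      c : IsColouring H (λ z → z ≡ value x ⊎ z ≡ value y) φ
      c = colouring-delete⁻ H _ (colourable x y x≢y)

      survives : ∀ {z} → OnPath z → ¬ (z ≡ value x ⊎ z ≡ value y)
      survives p = [ off-path x p , off-path y p ]′

      i≢    = proj₁ (sum-at-u c (survives (inj₁ refl)))
      uw≡   = proj₂ (sum-at-u c (survives (inj₁ refl)))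
      o≢    = proj₁ (sum-at-v c (survives (inj₂ (inj₂ refl))))
      vw≡   = proj₂ (sum-at-v c (survives (inj₂ (inj₂ refl))))
      uw≢vw = proj₁ (sum-at-w c (survives (inj₂ (inj₁ refl))))
      r≡    = proj₂ (sum-at-w c (survives (inj₂ (inj₁ refl))))

    -- Condition (i) speaks of dangling edges only, so the case of `y` adjacent to `u` by an edge of
    -- I is separate.
    monochromatic-I : (y : V pole) →
      ∃ λ φ → IsColouring H (λ z → z ≡ u ⊎ z ≡ value y) φ × φ (iᴴ zero) ≡ φ (iᴴ (suc zero))
    monochromatic-I y with attached {H} H.isGraph (other H (iᴴ zero)) | attached {H} H.isGraph (other H (iᴴ (suc zero)))
    ... | z₀ , ez₀ | z₁ , ez₁ = choose (_≟_ (finiteV H) z₀ (value y)) (_≟_ (finiteV H) z₁ (value y))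
      where
      Deleted : V H → Set
      Deleted z = z ≡ u ⊎ z ≡ value y

      deleted? : Decidable Deleted
      deleted? z = _≟_ (finiteV H) z u ⊎-dec _≟_ (finiteV H) z (value y)

      dangling : ∀ {e z} → at H e ≡ just u → at H (other H e) ≡ just z → z ≢ value y →
                 Dangling (deletePair H u (value y)) e
      dangling {e} eu ez z≢y = free-delete⁺ H deleted? e (inj₁ refl) eu ,
        subst Is-just (sym (at-delete⁺ H deleted? (other H e) [ (λ { refl → no-loop e eu ez }) , z≢y ]′ ez))
          (MaybeAny.just tt)

      -- The edge joining u to y is isolated in H − {u , y}.
      patch : ∀ {k l z} → k ≢ l → at H (other H (iᴴ k)) ≡ just (value y) → at H (other H (iᴴ l)) ≡ just z →
              ∃ λ φ → IsColouring H Deleted φ × φ (iᴴ k) ≡ φ (iᴴ l)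
      patch {k} {l} k≢l ky lz
        -- The other two edges at `u` do dangle: a second edge from `u` to `y` would be parallel to
        -- the first, and `w` differs from `y`. The isolated edge is then recoloured to match
        -- `iᴴ l`.
        with monochromatic u (inj₁ refl) y (iᴴ l) uw (iᴴ≢uw l) (at-iᴴ l) at-uw
               (dangling (at-iᴴ l) lz
                 (λ { refl → no-parallel (k≢l ∘ iᴴ-inj) (at-iᴴ k) (at-iᴴ l) ky lz }))
               (dangling at-uw at-wu (off-path y (inj₂ (inj₁ refl))))
      ... | ψ , _ = recolourEdge H (iᴴ k) a ψ′
        , recolourEdge-isColouring H (iᴴ k) a (in-𝕂 c (iᴴ l))
            (λ ev → inj₁ (just-injective (trans (sym ev) (at-iᴴ k))))
            (λ ev → inj₂ (just-injective (trans (sym ev) ky))) c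
        , trans (recolourEdge-on H (iᴴ k) a ψ′) (sym (recolourEdge-off H (iᴴ k) a ψ′
            (≢-sym k≢l ∘ iᴴ-inj) (λ eq → no-loop (iᴴ k) (at-iᴴ k) (trans (cong (at H) (sym eq)) (at-iᴴ l)))))
        where
        ψ′ = Colouring.colour ψ
        a  = ψ′ (iᴴ l)

        c : IsColouring H Deleted ψ′
        c = colouring-delete⁻ H _ ψ

      choose : Dec (z₀ ≡ value y) → Dec (z₁ ≡ value y) →
               ∃ λ φ → IsColouring H Deleted φ × φ (iᴴ zero) ≡ φ (iᴴ (suc zero))
      choose (yes refl) _ = patch 0≢1 ez₀ ez₁
      choose (no _) (yes refl) = let φ , c , eq = patch (≢-sym 0≢1) ez₁ ez₀ in φ , c , sym eq
      choose (no z₀≢y) (no z₁≢y) =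
        let φ , eq = monochromatic u (inj₁ refl) y _ _ (0≢1 ∘ iᴴ-inj) (at-iᴴ zero) (at-iᴴ (suc zero))
                       (dangling (at-iᴴ zero) ez₀ z₀≢y) (dangling (at-iᴴ (suc zero)) ez₁ z₁≢y)
        in Colouring.colour φ , colouring-delete⁻ H _ φ , eq

    -- Deleting `u` leaves `v` and `w` proper. At `v` the ends of O differ and `vw` has colour
    -- `total ω`; at `w` the residual colour differs from that of `vw`.
    colour-absorbing : (y : V pole) →
      ∃ λ z → ∃ λ ω → ∃ λ ρ → z ∈ 𝕂 × (∀ k → ω k ∈ 𝕂) × ρ ∈ 𝕂 ×
      ω zero ≢ ω (suc zero) × ρ ≢ total ω × Coloured N (_≡ y) (const z) ω ρ
    colour-absorbing y with φ , c , eq ← monochromatic-I y =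
      φ (iᴴ zero) , φ ∘ oᴴ , φ rᴴ , in-𝕂 c _ , in-𝕂 c ∘ oᴴ , in-𝕂 c _ , proj₁ at-v ,
      (λ r≡ → ⊕-≢ʳ (in-𝕂 c uw) (in-𝕂 c vw) (trans (sym (proj₂ at-w)) (trans r≡ (sym (proj₂ at-v))))) , record
        { φ = φ ∘ value
        ; isColouring = weaken
            (λ { {z} (inj₁ z≡u) → contradiction (sym z≡u) (off-path z (inj₁ refl))
               ; (inj₂ z≡y) → value-injective (¬? ∘ onPath?) z≡y }) (restrict c)
        ; φ-i = λ { zero → refl ; (suc zero) → sym eq }
        ; φ-o = λ _ → refl
        ; φ-r = refl
        }
      where
      at-v = sum-at-v c [ ≢-sym u≢v , off-path y (inj₂ (inj₂ refl)) ]′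
      at-w = sum-at-w c [ ≢-sym u≢w , off-path y (inj₂ (inj₁ refl)) ]′

    -- The residual colour agrees with I in the first colouring of (ii) and with O in the second.
    -- For `t ≢ z` the first is permuted, which forces `t` on I; for `t ≡ z` the second is, and I
    -- may get any colour other than `z`.
    colour-transmitting : (y : V pole) → ∀ {z t} → z ∈ 𝕂 → t ∈ 𝕂 →
      ∃ λ a → a ∈ 𝕂 × Coloured N (_≡ y) (const a) (const z) t
    colour-transmitting y {z} {t} z∈ t∈ with transmitting y | t ≟ᶜ z
    ... | a , b , a∈ , b∈ , a≢b , (φ , φ≡) , _ | no t≢z = t , t∈ ,
      permuted (send a b t z) (send-isRecolouring a b t z a∈ b∈ a≢b t∈ z∈ t≢z)
        (λ _ → send-a a b t z) (λ _ → send-b a b t z a≢b) (send-a a b t z)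
        (coloured (const a) (const b) (colouring-delete⁻ pole _ φ) φ≡)
    ... | a , b , a∈ , b∈ , a≢b , _ , (ψ , ψ≡) | yes refl with another-colour z
    ...   | c , c∈ , c≢z = c , c∈ ,
      permuted (send a b c z) (send-isRecolouring a b c z a∈ b∈ a≢b c∈ z∈ c≢z)
        (λ _ → send-a a b c z) (λ _ → send-b a b c z a≢b) (send-b a b c z a≢b)
        (coloured (const a) (const b) (colouring-delete⁻ pole _ ψ) ψ≡)

-- The ring of three negators

cyclic : (j k : Fin 3) → j ≢ k → k ≡ next j ⊎ j ≡ next k
cyclic = from-yes (Fin.all? λ (j : Fin 3) → Fin.all? λ (k : Fin 3) →
  ¬? (j Fin.≟ k) →-dec ((k Fin.≟ next j) ⊎-dec (j Fin.≟ next k)))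

next-surjective : (j : Fin 3) → ∃ λ k → next k ≡ j
next-surjective zero             = suc (suc zero) , refl
next-surjective (suc zero)       = zero , refl
next-surjective (suc (suc zero)) = suc zero , refl

-- Counting positions from `j` lets each case of bicriticality start at an arbitrary negator.
around : ∀ {ℓ} {A : Fin 3 → Set ℓ} j → A j → A (next j) → A (next (next j)) → ∀ k → A k
around zero             x y z zero             = x
around zero             x y z (suc zero)       = y
around zero             x y z (suc (suc zero)) = z
around (suc zero)       x y z zero             = z
around (suc zero)       x y z (suc zero)       = x
around (suc zero)       x y z (suc (suc zero)) = y
around (suc (suc zero)) x y z zero             = y
around (suc (suc zero)) x y z (suc zero)       = z
around (suc (suc zero)) x y z (suc (suc zero)) = x

⟨$⟩ʳ-injective : ∀ {n} (π : Permutation′ n) {k l} → π ⟨$⟩ʳ k ≡ π ⟨$⟩ʳ l → k ≡ l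
⟨$⟩ʳ-injective π eq = trans (sym (inverseˡ π)) (trans (cong (π ⟨$⟩ˡ_) eq) (inverseˡ π))

total-permuted : (π : Permutation′ 2) (ω : Fin 2 → ℤ₂×ℤ₂) → total (ω ∘ (π ⟨$⟩ʳ_)) ≡ total ω
total-permuted π ω with π ⟨$⟩ʳ zero in eq₀ | π ⟨$⟩ʳ suc zero in eq₁
... | zero     | suc zero = refl
... | suc zero | zero     = ⊕-comm (ω (suc zero)) (ω zero)
... | zero     | zero     = contradiction (⟨$⟩ʳ-injective π (trans eq₀ (sym eq₁))) 0≢1
... | suc zero | suc zero = contradiction (⟨$⟩ʳ-injective π (trans eq₀ (sym eq₁))) 0≢1

distinct-permuted : (π : Permutation′ 2) (ω : Fin 2 → ℤ₂×ℤ₂) → ω zero ≢ ω (suc zero) →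
                    ω (π ⟨$⟩ʳ zero) ≢ ω (π ⟨$⟩ʳ suc zero)
distinct-permuted π ω ω≢ with π ⟨$⟩ʳ zero in eq₀ | π ⟨$⟩ʳ suc zero in eq₁
... | zero     | suc zero = ω≢
... | suc zero | zero     = ≢-sym ω≢
... | zero     | zero     = contradiction (⟨$⟩ʳ-injective π (trans eq₀ (sym eq₁))) 0≢1
... | suc zero | suc zero = contradiction (⟨$⟩ʳ-injective π (trans eq₀ (sym eq₁))) 0≢1

-- Monochromatic and non-monochromatic connectors alternate around the ring,
-- which is impossible because the ring has odd length.
no-odd-ring : (σ : Fin 3 → Permutation′ 2) (I O : Fin 3 → Fin 2 → ℤ₂×ℤ₂) (ρ : Fin 3 → ℤ₂×ℤ₂) →
  (∀ j k → O j k ≡ I (next j) (σ j ⟨$⟩ʳ k)) →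
  ¬ (∀ j → Shape (I j zero) (I j (suc zero)) (O j zero) (O j (suc zero)) (ρ j))
no-odd-ring σ I O ρ match shapes = odd (mono? zero) (mono? (suc zero)) (mono? (suc (suc zero)))
  where
  Mono : (Fin 2 → ℤ₂×ℤ₂) → Set
  Mono α = α zero ≡ α (suc zero)

  mono? : ∀ j → Dec (Mono (I j))
  mono? j = I j zero ≟ᶜ I j (suc zero)

  mono-O⇒ : ∀ j → Mono (O j) → Mono (I (next j))
  mono-O⇒ j eq with mono? (next j)
  ... | yes p = p
  ... | no ¬p = contradiction (trans (sym (match j zero)) (trans eq (match j (suc zero))))
                  (distinct-permuted (σ j) (I (next j)) ¬p)

  mono-I⇒ : ∀ j → Mono (I (next j)) → Mono (O j)
  mono-I⇒ j eq with O j zero ≟ᶜ O j (suc zero)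
  ... | yes p = p
  ... | no ¬p = contradiction eq λ eq → distinct-permuted (flip (σ j)) (O j) ¬p
    (trans (trans (match j _) (cong (I (next j)) (inverseʳ (σ j))))
      (trans eq (sym (trans (match j _) (cong (I (next j)) (inverseʳ (σ j)))))))

  alternate₁ : ∀ j → Mono (I j) → ¬ Mono (I (next j))
  alternate₁ j p q with shapes j
  ... | inj₁ (_ , ¬o , _) = ¬o (mono-I⇒ j q)
  ... | inj₂ (_ , ¬i , _) = ¬i p

  alternate₂ : ∀ j → ¬ Mono (I j) → Mono (I (next j))
  alternate₂ j ¬p with shapes j
  ... | inj₁ (p , _) = contradiction p ¬p
  ... | inj₂ (q , _) = mono-O⇒ j q

  odd : Dec (Mono (I zero)) → Dec (Mono (I (suc zero))) → Dec (Mono (I (suc (suc zero)))) → ⊥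
  -- Among three answers in a cycle, two consecutive ones agree.
  odd (yes p) (yes q) _       = alternate₁ zero p q
  odd (no ¬p) (no ¬q) _       = ¬q (alternate₂ zero ¬p)
  odd _       (yes q) (yes r) = alternate₁ (suc zero) q r
  odd _       (no ¬q) (no ¬r) = ¬r (alternate₂ (suc zero) ¬q)
  odd (yes p) _       (yes r) = alternate₁ (suc (suc zero)) r p
  odd (no ¬p) _       (no ¬r) = ¬p (alternate₂ (suc (suc zero)) ¬r)

module _ {N : Negator} (perfect : Perfect N) (π : Permutation′ 2) {D : V (Negator.pole N) → Set}
  {a : ℤ₂×ℤ₂} {ω : Fin 2 → ℤ₂×ℤ₂} (a∈ : a ∈ 𝕂) (ω∈ : ∀ k → ω k ∈ 𝕂) (ω≢ : ω zero ≢ ω (suc zero))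
  where
  open NegatorProperties N

  -- The residual colour is a commutative sum over the connector, so it does not depend on the
  -- bijection `π`.
  realise-out : Coloured N D (const a) (ω ∘ (π ⟨$⟩ʳ_)) (total ω)
  realise-out = realise perfect (const a∈) (ω∈ ∘ (π ⟨$⟩ʳ_))
    (inj₁ (refl , distinct-permuted π ω ω≢ , sym (total-permuted π ω)))

  realise-in : Coloured N D (ω ∘ (π ⟨$⟩ʳ_)) (const a) (total ω)
  realise-in = realise perfect (ω∈ ∘ (π ⟨$⟩ʳ_)) (const a∈)
    (inj₂ (refl , distinct-permuted π ω ω≢ , sym (total-permuted π ω)))

-- The graph `NNN`: no free ends, connectedness, uncolourability

module _ (N : Fin 3 → Negator) (σ : Fin 3 → Permutation′ 2) where

  private
    module N j = Negator (N j)

    G : Multipole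
    G = NNN N σ

    open module JP = JunctionProperties (poles N σ) (finite-Σ (finite-Fin 3) (λ _ → finite-Fin 2)) (outs N σ) (ins N σ)
      (free-joined N σ) (injective-joined N σ) (no-edge-joined N σ)

  free-residual : ∀ j → Free (ring N σ) (residual N σ j)
  free-residual j = cong (Maybe.map (j ,_)) (N.free-r j)

  residual-injective : Injective _≡_ _≡_ (residual N σ)
  residual-injective eq = tags N σ (cong value eq)

  private
    open module AP = AddVertexProperties (ring N σ) (residual N σ) free-residual residual-injective

  i-joined : ∀ j k → Joined (j , N.i j k)
  i-joined j k with next-surjective j
  ... | j′ , refl = inj₂ (j′ , σ j′ ⟨$⟩ˡ k) , cong (λ l → j , N.i j l) (inverseʳ (σ j′))

  -- Each free end of a pole is used up: those in I and O by the junctions, `r` by the new vertex.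
  isGraph : IsGraph G
  isGraph e@((j , e′) , [ unjoined ]) free with isR? e
  isGraph e@((j , e′) , [ unjoined ]) ()   | yes _
  ... | no ¬r with at (N.pole j) e′ in eq
  isGraph e@((j , e′) , [ unjoined ]) () | no ¬r | just _
  ...   | nothing with NegatorProperties.free-pole (N j) e′ eq
  ...     | inj₁ (k , refl)        = contradiction (i-joined j k) (¬-recompute unjoined)
  ...     | inj₂ (inj₁ (k , refl)) = contradiction (inj₁ (j , k) , refl) (¬-recompute unjoined)
  ...     | inj₂ (inj₂ refl)       = contradiction (j , refl) ¬r

  adjacent-∐ : ∀ j {x y} → Adjacent (N.pole j) x y → Adjacent (poles N σ) (j , x) (j , y)
  adjacent-∐ j (e , ex , ey) = (j , e) , cong (Maybe.map (j ,_)) ex , cong (Maybe.map (j ,_)) ey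

  adjacent-G : ∀ j {x y} → Adjacent (N.pole j) x y → Adjacent G (just (j , x)) (just (j , y))
  adjacent-G j {x} {y} a = adjacent-addVertex {j , x} {j , y} (adjacent-junction {j , x} {j , y} (adjacent-∐ j a))

  adjacent-r : ∀ j {y} → at (N.pole j) (other (N.pole j) (N.r j)) ≡ just y → Adjacent G nothing (just (j , y))
  adjacent-r j {y} ry = adjacent-new j {j , y}
    (at-other-junction (residual N σ j) {j , y} (cong (Maybe.map (j ,_)) ry))

  module _ (perfect : ∀ j → Perfect (N j)) where

    to-new : ∀ x → Star (Adjacent G) x nothing
    to-new nothing = ε
    to-new (just (j , x)) = let y , xy , ry = NegatorProperties.reaches-r (N j) (perfect j) x in
      gmap (λ z → just (j , z)) (adjacent-G j) xy ◅◅ (Adjacent-sym G {nothing} {just (j , y)} (adjacent-r j ry) ◅ ε)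

    connected : Connected G
    connected x y = to-new x ◅◅ reverse (λ {x} {y} → Adjacent-sym G {x} {y}) (to-new y)

    -- Removing the new vertex and undoing the junctions turns a colouring of `G` into colourings of
    -- three whole poles whose connectors match.
    uncolourable : ¬ Colouring G
    uncolourable φ =
      no-odd-ring σ (λ j k → χ (j , N.i j k)) (λ j k → χ (j , N.o j k)) (λ j → χ (j , N.r j))
        (λ j k → unjoin-match c (j , k))
        (λ j → NegatorProperties.shape (N j) (perfect j) (∐-component N.pole {χ} χ-isColouring j))
      where
      c : IsColouring (ring N σ) (const ⊥) (Colouring.colour φ)
      c = addVertex-old (colouring⇒ φ)

      χ : End (poles N σ) → ℤ₂×ℤ₂
      χ = unjoin (Colouring.colour φ)

      χ-isColouring : IsColouring (poles N σ) (const ⊥) χ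
      χ-isColouring = unjoin-isColouring c

  -- Comparing consecutive residual colours suffices, because any two of three negators are
  -- consecutive in one of the two orders.
  glue : ∀ D {α ω : Fin 3 → Fin 2 → ℤ₂×ℤ₂} {ρ : Fin 3 → ℤ₂×ℤ₂} →
    (∀ j → Coloured (N j) (λ v → D (just (j , v))) (α j) (ω j) (ρ j)) →
    (∀ j k → ω j k ≡ α (next j) (σ j ⟨$⟩ʳ k)) →
    (¬ D nothing → ∀ j → ρ j ≢ ρ (next j)) →
    ∃ (IsColouring G D)
  glue D {α} {ω} {ρ} c match distinct = _ ,
    addVertex-isColouring injective-ρ
      (junction-isColouring
        (λ (j , k) → trans (C.φ-o j k) (trans (match j k) (sym (C.φ-i (next j) _))))
        (∐-isColouring _ {D = D ∘ just} C.isColouring))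
    where
    module C j = Coloured (c j)

    injective-ρ : ¬ D nothing → ∀ {j k} → C.φ j (N.r j) ≡ C.φ k (N.r k) → j ≡ k
    injective-ρ ¬D {j} {k} eq with j Fin.≟ k
    ... | yes j≡k = j≡k
    ... | no j≢k with ρ≡ ← trans (sym (C.φ-r j)) (trans eq (C.φ-r k)) | cyclic j k j≢k
    ...   | inj₁ refl = contradiction ρ≡ (distinct ¬D j)
    ...   | inj₂ refl = contradiction (sym ρ≡) (distinct ¬D k)

  -- Splitting on `j` makes the third successor of `j` compute to `j`, which closes the ring in the
  -- last matching condition.
  glue-from : ∀ D j {α₀ α₁ α₂ ω₀ ω₁ ω₂ : Fin 2 → ℤ₂×ℤ₂} {ρ₀ ρ₁ ρ₂ : ℤ₂×ℤ₂} →
    Coloured (N j) (λ v → D (just (j , v))) α₀ ω₀ ρ₀ →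
    Coloured (N (next j)) (λ v → D (just (next j , v))) α₁ ω₁ ρ₁ →
    Coloured (N (next (next j))) (λ v → D (just (next (next j) , v))) α₂ ω₂ ρ₂ →
    (∀ k → ω₀ k ≡ α₁ (σ j ⟨$⟩ʳ k)) →
    (∀ k → ω₁ k ≡ α₂ (σ (next j) ⟨$⟩ʳ k)) →
    (∀ k → ω₂ k ≡ α₀ (σ (next (next j)) ⟨$⟩ʳ k)) →
    (¬ D nothing → ρ₀ ≢ ρ₁ × ρ₁ ≢ ρ₂ × ρ₂ ≢ ρ₀) →
    ∃ (IsColouring G D)
  glue-from D zero {α₀} {α₁} {α₂} {ω₀} {ω₁} {ω₂} {ρ₀} {ρ₁} {ρ₂} c₀ c₁ c₂ m₀ m₁ m₂ d =
    glue D {around zero α₀ α₁ α₂} {around zero ω₀ ω₁ ω₂} {around zero ρ₀ ρ₁ ρ₂}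
      (around zero c₀ c₁ c₂) (around zero m₀ m₁ m₂)
      (λ ¬D → let d₀ , d₁ , d₂ = d ¬D in around zero d₀ d₁ d₂)
  glue-from D (suc zero) {α₀} {α₁} {α₂} {ω₀} {ω₁} {ω₂} {ρ₀} {ρ₁} {ρ₂} c₀ c₁ c₂ m₀ m₁ m₂ d =
    glue D {around (suc zero) α₀ α₁ α₂} {around (suc zero) ω₀ ω₁ ω₂} {around (suc zero) ρ₀ ρ₁ ρ₂}
      (around (suc zero) c₀ c₁ c₂) (around (suc zero) m₀ m₁ m₂)
      (λ ¬D → let d₀ , d₁ , d₂ = d ¬D in around (suc zero) d₀ d₁ d₂)
  glue-from D (suc (suc zero)) {α₀} {α₁} {α₂} {ω₀} {ω₁} {ω₂} {ρ₀} {ρ₁} {ρ₂} c₀ c₁ c₂ m₀ m₁ m₂ d =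
    glue D {around (suc (suc zero)) α₀ α₁ α₂} {around (suc (suc zero)) ω₀ ω₁ ω₂} {around (suc (suc zero)) ρ₀ ρ₁ ρ₂}
      (around (suc (suc zero)) c₀ c₁ c₂) (around (suc (suc zero)) m₀ m₁ m₂)
      (λ ¬D → let d₀ , d₁ , d₂ = d ¬D in around (suc (suc zero)) d₀ d₁ d₂)

  -- Bicriticality

  module _ (feasible : ∀ j → Feasible (N j)) (perfect : ∀ j → Perfect (N j)) where

    private
      module P j = NegatorProperties (N j)

      Deleted : V G → V G → V G → Set
      Deleted x y z = z ≡ x ⊎ z ≡ y

      -- When O of one pole is prescribed as `ω`, I of the next must carry `ω` composed with the
      -- inverse bijection.
      return : ∀ j (ω : Fin 2 → ℤ₂×ℤ₂) k → ω k ≡ ω (flip (σ j) ⟨$⟩ʳ (σ j ⟨$⟩ʳ k))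
      return j ω k = cong ω (sym (inverseˡ (σ j)))

    colour-new : ∀ j y → ∃ (IsColouring G (Deleted nothing (just (j , y))))
    colour-new j y =
      -- The colour (0,1) is an arbitrary choice for both arguments; with the new vertex deleted,
      -- the residual colours need not be distinct.
      let a , a∈ , c₀ = P.colour-transmitting j (feasible j) y (here refl) (here refl) in
      glue-from _ j
        (weaken-coloured (λ { refl → inj₂ refl }) c₀)
        (realise-out (perfect (next j)) Permutation.id (here refl) ω∈ (λ ()))
        (realise-in (perfect (next (next j))) (flip (σ (next j))) a∈ ω∈ (λ ()))
        (λ _ → refl) (return (next j) (pair _ _)) (λ _ → refl)
        (λ ¬D → contradiction (inj₁ refl) ¬D)
      where
      ω∈ : ∀ k → pair (false , true) (true , false) k ∈ 𝕂
      ω∈ = pair∈ (here refl) (there (here refl))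

    colour-same : ∀ j x y → x ≢ y → ∃ (IsColouring G (Deleted (just (j , x)) (just (j , y))))
    colour-same j x y x≢y =
      let α , ω , α∈ , ω∈ , α≢ , ω≢ , α≢ω , c₀ = P.colour-pair j (feasible j) x y x≢y
          Σα∈ = ⊕∈𝕂 (α∈ zero) (α∈ (suc zero)) α≢
          Σω∈ = ⊕∈𝕂 (ω∈ zero) (ω∈ (suc zero)) ω≢
      in glue-from _ j
        (weaken-coloured (Sum.map (cong (λ z → just (j , z))) (cong (λ z → just (j , z)))) c₀)
        (realise-in (perfect (next j)) (flip (σ j)) (here refl) ω∈ ω≢)
        (realise-out (perfect (next (next j))) (σ (next (next j))) (here refl) α∈ α≢)
        (return j ω) (λ _ → refl) (λ _ → refl)
        -- The residual colours are `total α ⊕ total ω`, `total ω` and `total α`, that is, all three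
        -- colours.
        (λ _ → ⊕-≢ʳ Σα∈ Σω∈ , ≢-sym α≢ω , ≢-sym (⊕-≢ˡ Σα∈ Σω∈))

    colour-consecutive : ∀ j x y → ∃ (IsColouring G (Deleted (just (j , x)) (just (next j , y))))
    colour-consecutive j x y =
      let z , ω , ρ , z∈ , ω∈ , ρ∈ , ω≢ , ρ≢ , c₁ = P.colour-absorbing (next j) (feasible (next j)) y
          Σω∈ = ⊕∈𝕂 (ω∈ zero) (ω∈ (suc zero)) ω≢
          -- The second and third poles have residual colours `ρ` and `total ω`, so the first must
          -- supply their sum, with `z` on its O.
          a , a∈ , c₀ = P.colour-transmitting j (feasible j) x z∈ (⊕∈𝕂 ρ∈ Σω∈ ρ≢)
      in glue-from _ j
        (weaken-coloured (λ { refl → inj₁ refl }) c₀)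
        (weaken-coloured (λ { refl → inj₂ refl }) c₁)
        (realise-in (perfect (next (next j))) (flip (σ (next j))) a∈ ω∈ ω≢)
        (λ _ → refl) (return (next j) ω) (λ _ → refl)
        (λ _ → ⊕-≢ˡ ρ∈ Σω∈ , ρ≢ , ≢-sym (⊕-≢ʳ ρ∈ Σω∈))

    colour-poles : ∀ {j k} x y → Dec (j ≡ k) → just (j , x) ≢ just (k , y) →
                   ∃ (IsColouring G (Deleted (just (j , x)) (just (k , y))))
    colour-poles {j} {k} x y (yes refl) x≢y = colour-same j x y (x≢y ∘ cong (λ z → just (j , z)))
    colour-poles {j} {k} x y (no j≢k)   _   = arrange (cyclic j k j≢k)
      where
      arrange : k ≡ next j ⊎ j ≡ next k → ∃ (IsColouring G (Deleted (just (j , x)) (just (k , y))))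
      arrange (inj₁ refl) = colour-consecutive j x y
      arrange (inj₂ refl) = let φ , c = colour-consecutive k y x in φ , weaken swap c

    colour-two : ∀ x y → x ≢ y → ∃ (IsColouring G (Deleted x y))
    colour-two nothing        nothing        x≢y = contradiction refl x≢y
    colour-two nothing        (just (j , y)) _   = colour-new j y
    colour-two (just (j , x)) nothing        _   = let φ , c = colour-new j x in φ , weaken swap c
    colour-two (just (j , x)) (just (k , y)) x≢y = colour-poles x y (j Fin.≟ k) x≢y

theorem15 : (N : Fin 3 → Negator) →
    (∀ j → Feasible (N j)) →
    (∀ j → Perfect (N j)) →
    (σ : Fin 3 → Permutation′ 2) →
    IsBicriticalSnark (NNN N σ)
theorem15 N feasible perfect σ = record
  { isSnark = record
    { isGraph      = isGraph N σ
    ; connected    = connected N σ perfect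
    ; uncolourable = uncolourable N σ perfect
    }
  ; bicritical = λ x y x≢y → colouring-delete⁺ _ _ (proj₂ (colour-two N σ feasible perfect x y x≢y))
  }
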